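{- Let $K$ be a number field and let $g\in K[z]$ be a bicritical polynomial of degree $d\ge 3$ with set of critical points $\{\gamma_1,\gamma_2\}\subseteq K$. Then there exists an element $\phi\in \mathrm{PGL}_2(K)$ (an affine map $\phi(z)=\alpha z+\beta$ with $\alpha,\beta\in K$, $\alpha\ne0$) such that $\phi\circ g\circ\phi^{ -1}=a\,\mathcal{B}_{d,k}+c$ for some $k\in\mathbb{N}$ (with $1\le k<d-1$) and some $a,c\in K$.
   Context: Critical points of $g$ are the $\alpha\in\overline K$ with $g'(\alpha)=0$; $g$ is bicritical if it has exactly two distinct critical points. For integers $d\ge 3$ and $1\le k<d-1$, $$\mathcal{B}_{d,k}(z)=\left(\frac{1}{k!}\prod_{j=0}^{k}(d-j)\right)z^{d-k}\sum_{i=0}^{k}\frac{(-1)^i}{d-k+i}\binom{k}{i}z^i,$$ a polynomial of degree $d$ with critical points $0$ and $1$, both fixed, whose derivative is a constant multiple of $z^{d-k-1}(z-1)^k$. -}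

module Defs where

open import Level using (Level; 0ℓ; _⊔_) renaming (suc to lsuc)
open import Algebra.Bundles using (CommutativeRing)
open import Algebra.Morphism.Structures using (module RingMorphisms)
import Algebra.Definitions as AlgDefs
import Algebra.Definitions.RawMonoid as RawMonoidDefs
open import Data.Fin.Base using (Fin)
open import Data.Integer.Base as ℤ using (ℤ; +_; -1ℤ)
open import Data.List.Base as List using (List; []; _∷_; map; foldr; applyUpTo)
open import Data.Nat.Base as ℕ using (ℕ; zero; suc; _∸_; _<_; _≤_; NonZero; _!)
open import Data.Nat.Combinatorics using (_C_)
import Data.Nat.ListAction as ℕList
import Data.Nat.Properties as ℕₚ
open import Data.Product.Base using (Σ; ∃; _×_; _,_; proj₁; proj₂)
open import Data.Rational.Base as ℚ using (ℚ; 0ℚ)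
import Data.Rational.Properties as ℚₚ
open import Data.Vec.Functional using (Vector)
open import Relation.Binary.PropositionalEquality.Core using (_≡_)
open import Relation.Nullary.Negation.Core using (¬_)
open import Relation.Unary using (Pred; _∪_; _≐_)

-- A polynomial is its list of coefficients, constant term first. Trailing
-- zeros are allowed, so equality of polynomials is _≈ₚ_, not _≡_.
module Poly {c ℓ : Level} (R : CommutativeRing c ℓ) where

  open CommutativeRing R
  open RawMonoidDefs +-rawMonoid using () renaming (_×_ to _×ℕ_)

  Polynomial : Set c
  Polynomial = List Carrier

  coeff : Polynomial → ℕ → Carrier
  coeff []      _       = 0#
  coeff (a ∷ p) zero    = a
  coeff (a ∷ p) (suc n) = coeff p n

  infix 4 _≈ₚ_
  _≈ₚ_ : Polynomial → Polynomial → Set ℓ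
  p ≈ₚ q = ∀ n → coeff p n ≈ coeff q n

  HasDegree : Polynomial → ℕ → Set ℓ
  HasDegree p d = ¬ (coeff p d ≈ 0#) × (∀ n → d < n → coeff p n ≈ 0#)

  constant : Carrier → Polynomial
  constant a = a ∷ []

  X : Polynomial
  X = 0# ∷ 1# ∷ []

  infixl 6 _+ₚ_
  infixl 7 _*ₚ_
  infixr 7 _•_
  infixr 8 _^ₚ_
  infixr 9 _∘ₚ_

  _+ₚ_ : Polynomial → Polynomial → Polynomial
  []      +ₚ q       = q
  (a ∷ p) +ₚ []      = a ∷ p
  (a ∷ p) +ₚ (b ∷ q) = a + b ∷ p +ₚ q

  _•_ : Carrier → Polynomial → Polynomial
  a • p = map (a *_) p

  _*ₚ_ : Polynomial → Polynomial → Polynomial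
  []      *ₚ q = []
  (a ∷ p) *ₚ q = a • q +ₚ (0# ∷ p *ₚ q)

  _^ₚ_ : Polynomial → ℕ → Polynomial
  p ^ₚ zero  = constant 1#
  p ^ₚ suc n = p *ₚ p ^ₚ n

  eval : Polynomial → Carrier → Carrier
  eval p x = foldr (λ a r → a + x * r) 0# p

  _∘ₚ_ : Polynomial → Polynomial → Polynomial
  p ∘ₚ q = foldr (λ a r → constant a +ₚ q *ₚ r) [] p

  -- derivFrom i [a₀, a₁, …] = [i a₀, (i+1) a₁, …]
  derivFrom : ℕ → Polynomial → Polynomial
  derivFrom i []      = []
  derivFrom i (a ∷ p) = i ×ℕ a ∷ derivFrom (suc i) p

  deriv : Polynomial → Polynomial
  deriv []      = []
  deriv (_ ∷ p) = derivFrom 1 p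

record Field (c ℓ : Level) : Set (lsuc (c ⊔ ℓ)) where
  field
    commutativeRing : CommutativeRing c ℓ

  open CommutativeRing commutativeRing public

  field
    0≉1        : ¬ (0# ≈ 1#)
    invertible : ∀ x → ¬ (x ≈ 0#) → AlgDefs.Invertible _≈_ 1# _*_ x

  inv : ∀ x → ¬ (x ≈ 0#) → Carrier
  inv x x≉0 = proj₁ (invertible x x≉0)

  inv≉0 : ∀ x (x≉0 : ¬ (x ≈ 0#)) → ¬ (inv x x≉0 ≈ 0#)
  inv≉0 x x≉0 y≈0 =
    0≉1 (trans (sym (zeroˡ x))
               (trans (*-congʳ (sym y≈0)) (proj₁ (proj₂ (invertible x x≉0)))))

  open Poly commutativeRing public

module _ {c ℓ c′ ℓ′ : Level} (R : CommutativeRing c ℓ) (S : CommutativeRing c′ ℓ′) where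
  private
    module R = CommutativeRing R
    module S = CommutativeRing S

  IsRingHom : (R.Carrier → S.Carrier) → Set (c ⊔ ℓ ⊔ ℓ′)
  IsRingHom = RingMorphisms.IsRingHomomorphism R.rawRing S.rawRing

-- A field that is finite-dimensional over ℚ: finite-dimensionality is given by
-- a basis.
record NumberField (c ℓ : Level) : Set (lsuc (c ⊔ ℓ)) where
  field
    asField : Field c ℓ

  open Field asField public
  open RawMonoidDefs +-rawMonoid using (sum)

  field
    fromℚ       : ℚ → Carrier
    fromℚ-isHom : IsRingHom ℚₚ.+-*-commutativeRing commutativeRing fromℚ
    dim         : ℕ
    basis       : Vector Carrier dim

  combination : Vector ℚ dim → Carrier
  combination q = sum (λ i → fromℚ (q i) * basis i)

  field
    spanning    : ∀ x → ∃ λ q → x ≈ combination q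
    independent : ∀ q → combination q ≈ 0# → ∀ i → q i ≡ 0ℚ

record AlgebraicClosure {c ℓ : Level} (K : Field c ℓ) (c′ ℓ′ : Level)
       : Set (c ⊔ ℓ ⊔ lsuc (c′ ⊔ ℓ′)) where
  private module K = Field K
  field
    closure : Field c′ ℓ′

  private module K̄ = Field closure

  field
    embed       : K.Carrier → K̄.Carrier
    embed-isHom : IsRingHom K.commutativeRing K̄.commutativeRing embed
    algebraic   : ∀ x → ∃ λ p → ¬ (p K.≈ₚ []) × K̄.eval (map embed p) x K̄.≈ K̄.0#
    closed      : ∀ p n → 1 ≤ n → K̄.HasDegree p n → ∃ λ x → K̄.eval p x K̄.≈ K̄.0#

module Critical {c ℓ c′ ℓ′ : Level} (K : Field c ℓ) (K̄ : AlgebraicClosure K c′ ℓ′) where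
  open AlgebraicClosure K̄ using (closure; embed)
  open Field closure using (Carrier; _≈_; 0#; eval)
  open Field K using (Polynomial; deriv)

  CriticalPoint : Polynomial → Pred Carrier ℓ′
  CriticalPoint g x = eval (map embed (deriv g)) x ≈ 0#

  ｛_,_｝ : Carrier → Carrier → Pred Carrier ℓ′
  ｛ x , y ｝ = (_≈ x) ∪ (_≈ y)

  Bicritical : Polynomial → Set (c′ ⊔ ℓ′)
  Bicritical g = ∃ λ x → ∃ λ y → ¬ (x ≈ y) × (CriticalPoint g ≐ ｛ x , y ｝)

-- The affine maps z ↦ αz + β with α ≠ 0, i.e. the elements of PGL₂(K) that
-- fix ∞.
module AffineMaps {c ℓ : Level} (K : Field c ℓ) where
  open Field K

  record Affine : Set (c ⊔ ℓ) where
    constructor affine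
    field
      α   : Carrier
      β   : Carrier
      α≉0 : ¬ (α ≈ 0#)

  toPoly : Affine → Polynomial
  toPoly φ = Affine.α φ • X +ₚ constant (Affine.β φ)

  inverse : Affine → Affine
  inverse (affine α β α≉0) = affine (inv α α≉0) (- (inv α α≉0 * β)) (inv≉0 α α≉0)

  conjugate : Affine → Polynomial → Polynomial
  conjugate φ g = toPoly φ ∘ₚ g ∘ₚ toPoly (inverse φ)

denominator-nonZero : ∀ d k → k < d ∸ 1 → ∀ i → NonZero ((d ∸ k) ℕ.+ i)
denominator-nonZero d k k<d-1 i =
  ℕ.>-nonZero (ℕₚ.<-≤-trans (ℕₚ.m<n⇒0<n∸m (ℕₚ.<-≤-trans k<d-1 (ℕₚ.m∸n≤m d 1)))
                            (ℕₚ.m≤m+n (d ∸ k) i))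

-- 𝓑 has rational coefficients; over K it is read through fromℚ. The truncated
-- subtractions d ∸ k and d ∸ j (j ≤ k) are honest because k < d ∸ 1.
module _ (d k : ℕ) (k<d-1 : k < d ∸ 1) where
  open Poly ℚₚ.+-*-commutativeRing

  𝓑-factor : ℚ
  𝓑-factor = ℚ._/_ (+ ℕList.product (applyUpTo (d ∸_) (suc k))) (k !) {{k ℕₚ.!≢0}}

  𝓑-coeff : ℕ → ℚ
  𝓑-coeff i = ℚ._/_ (-1ℤ ℤ.^ i ℤ.* + (k C i)) ((d ∸ k) ℕ.+ i)
                    {{denominator-nonZero d k k<d-1 i}}

  𝓑 : Polynomial
  𝓑 = 𝓑-factor • (X ^ₚ (d ∸ k) *ₚ applyUpTo 𝓑-coeff (suc k))

-- Over K, split the roots γ₁ and γ₂ off g′, leaving a cofactor h with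
-- h(γ₁), h(γ₂) ≠ 0. A root of h in K̄ would be a third critical point, so h is
-- a constant b and g′ = b (z - γ₁)^m (z - γ₂)^n with m + n = d - 1 and
-- m, n ≥ 1. Take φ with φ(γ₁) = 0 and φ(γ₂) = 1, so that φ⁻¹(z) = δz + γ₁ for
-- δ = γ₂ - γ₁; the derivative of φ ∘ g ∘ φ⁻¹ is a multiple of z^m (1 - z)^n, and
-- by the binomial theorem so is the derivative of 𝓑 for k = n. In
-- characteristic 0, equal derivatives leave only a difference of constant terms.
--
-- The case distinctions are constructive: equality in K is decidable, by
-- comparing coordinates in the basis over ℚ. Identities between polynomials are
-- proved by evaluating both sides at every point of the infinite field K.
module Submission where

open import Defs
open import Level using (Level; _⊔_)
open import Algebra.Bundles using (CommutativeRing)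
import Algebra.Morphism.Construct.Identity as Identity
open import Algebra.Morphism.Structures using (module RingMorphisms)
import Algebra.Properties.CommutativeMonoid.Mult as MonoidMult
import Algebra.Properties.CommutativeSemiring.Binomial as Binomial
import Algebra.Properties.CommutativeSemiring.Exp as CommutativeSemiringExp
import Algebra.Properties.Ring as RingProperties
import Algebra.Properties.Semiring.Exp as SemiringExp
import Algebra.Properties.Semiring.Mult as SemiringMult
import Algebra.Properties.Semiring.Sum as SemiringSum
import Algebra.Solver.Ring.NaturalCoefficients.Default as SemiringSolver
open import Data.Fin.Base using (toℕ)
import Data.Fin.Properties as Finₚ
open import Data.Integer.Base as ℤ using (ℤ; +_; -1ℤ)
import Data.Integer.Properties as ℤₚ
open import Data.Integer.Tactic.RingSolver using (solve-∀)
open import Data.List.Base using ([]; _∷_; map; foldr; length; applyUpTo)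
import Data.List.Relation.Unary.All.Properties as Allₚ
open import Data.Nat.Base as ℕ using (ℕ; zero; suc; _≤_; _<_; _∸_; s≤s; z≤n; _!)
open import Data.Nat.Combinatorics using (_C_)
import Data.Nat.ListAction as ℕList
import Data.Nat.ListAction.Properties as ℕListₚ
import Data.Nat.Properties as ℕₚ
open import Data.Product.Base using (Σ; ∃; _×_; _,_; proj₁; proj₂)
open import Data.Rational.Base as ℚ using (0ℚ; 1ℚ; fromℚᵘ; toℚᵘ)
import Data.Rational.Properties as ℚₚ
open import Data.Rational.Unnormalised.Base as ℚᵘ using (mkℚᵘ; *≡*)
import Data.Rational.Unnormalised.Properties as ℚᵘₚ
open import Data.Sum.Base using (_⊎_; inj₁; inj₂; [_,_]′)
open import Function.Base using (id; _∘_)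
open import Relation.Binary.PropositionalEquality.Core as ≡ using (_≡_)
import Relation.Binary.Reasoning.Setoid as SetoidReasoning
open import Relation.Nullary using (Dec; yes; no)
open import Relation.Nullary.Negation.Core using (¬_; contradiction)
open import Relation.Unary using (_≐_)

-- Coefficients, degrees and division by a linear factor.

module Coefficients {c ℓ : Level} (R : CommutativeRing c ℓ) where
  open CommutativeRing R
  open Poly R
  open RingProperties ring using (-‿distribˡ-*)
  open SemiringMult semiring using (×-congˡ) renaming (_×_ to _·_)
  open SetoidReasoning setoid

  ·-zeroʳ : ∀ n → n · 0# ≈ 0#
  ·-zeroʳ zero    = refl
  ·-zeroʳ (suc n) = trans (+-identityˡ _) (·-zeroʳ n)

  coeff-+ₚ : ∀ p q n → coeff (p +ₚ q) n ≈ coeff p n + coeff q n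
  coeff-+ₚ []      q       n       = sym (+-identityˡ _)
  coeff-+ₚ (a ∷ p) []      n       = sym (+-identityʳ _)
  coeff-+ₚ (a ∷ p) (b ∷ q) zero    = refl
  coeff-+ₚ (a ∷ p) (b ∷ q) (suc n) = coeff-+ₚ p q n

  coeff-• : ∀ a p n → coeff (a • p) n ≈ a * coeff p n
  coeff-• a []      n       = sym (zeroʳ a)
  coeff-• a (b ∷ p) zero    = refl
  coeff-• a (b ∷ p) (suc n) = coeff-• a p n

  coeff-derivFrom : ∀ i p n → coeff (derivFrom i p) n ≈ (i ℕ.+ n) · coeff p n
  coeff-derivFrom i []      n       = sym (·-zeroʳ (i ℕ.+ n))
  coeff-derivFrom i (a ∷ p) zero    = ×-congˡ (≡.sym (ℕₚ.+-identityʳ i))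
  coeff-derivFrom i (a ∷ p) (suc n) =
    trans (coeff-derivFrom (suc i) p n) (×-congˡ (≡.sym (ℕₚ.+-suc i n)))

  coeff-deriv : ∀ p n → coeff (deriv p) n ≈ suc n · coeff p (suc n)
  coeff-deriv []      n = coeff-derivFrom 1 [] n
  coeff-deriv (a ∷ p) n = coeff-derivFrom 1 p n

  HasDegree-unique : ∀ p q {m n} → p ≈ₚ q → HasDegree p m → HasDegree q n → m ≡ n
  HasDegree-unique p q {m} {n} p≈q (pₘ≉0 , p>m) (qₙ≉0 , q>n) =
    ℕₚ.≤-antisym (ℕₚ.≮⇒≥ λ n<m → pₘ≉0 (trans (p≈q m) (q>n m n<m)))
                 (ℕₚ.≮⇒≥ λ m<n → qₙ≉0 (trans (sym (p≈q n)) (p>m n m<n)))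

  -- The product (X - a) q, expanded as -aq + Xq so that each coefficient is a sum of two terms.
  mulLinear : Carrier → Polynomial → Polynomial
  mulLinear a q = (- a) • q +ₚ (0# ∷ q)

  mulLinearPow : Carrier → ℕ → Polynomial → Polynomial
  mulLinearPow a zero    q = q
  mulLinearPow a (suc m) q = mulLinear a (mulLinearPow a m q)

  coeff-mulLinear : ∀ a q n → coeff (mulLinear a q) n ≈ - a * coeff q n + coeff (0# ∷ q) n
  coeff-mulLinear a q n = trans (coeff-+ₚ ((- a) • q) (0# ∷ q) n) (+-congʳ (coeff-• (- a) q n))

  ∷-cong : ∀ {a b p q} → a ≈ b → p ≈ₚ q → (a ∷ p) ≈ₚ (b ∷ q)
  ∷-cong a≈b p≈q zero    = a≈b
  ∷-cong a≈b p≈q (suc n) = p≈q n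

  mulLinear-cong : ∀ a p q → p ≈ₚ q → mulLinear a p ≈ₚ mulLinear a q
  mulLinear-cong a p q p≈q n = begin
    coeff (mulLinear a p) n             ≈⟨ coeff-mulLinear a p n ⟩
    - a * coeff p n + coeff (0# ∷ p) n  ≈⟨ +-cong (*-congˡ (p≈q n)) (∷-cong refl p≈q n) ⟩
    - a * coeff q n + coeff (0# ∷ q) n  ≈⟨ coeff-mulLinear a q n ⟨
    coeff (mulLinear a q) n             ∎

  mulLinear-≈[] : ∀ a q → q ≈ₚ [] → mulLinear a q ≈ₚ []
  -- `mulLinear a []` computes to `0# ∷ []`, which agrees with `[]` only up to `_≈ₚ_`.
  mulLinear-≈[] a q q≈[] n = trans (mulLinear-cong a q [] q≈[] n) (0∷[]≈[] n)
    where
    0∷[]≈[] : (0# ∷ []) ≈ₚ []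
    0∷[]≈[] zero    = refl
    0∷[]≈[] (suc _) = refl

  mulLinearPow-cong : ∀ a m p q → p ≈ₚ q → mulLinearPow a m p ≈ₚ mulLinearPow a m q
  mulLinearPow-cong a zero    p q p≈q = p≈q
  mulLinearPow-cong a (suc m) p q p≈q = mulLinear-cong a (mulLinearPow a m p) (mulLinearPow a m q) (mulLinearPow-cong a m p q p≈q)

  HasDegree-mulLinear : ∀ a q {n} → HasDegree q n → HasDegree (mulLinear a q) (suc n)
  HasDegree-mulLinear a q {n} (qₙ≉0 , q>n) =
    (λ ≈0 → qₙ≉0 (trans (sym (top n ℕₚ.≤-refl)) ≈0)) ,
    λ { (suc m) (s≤s n<m) → trans (top m (ℕₚ.<⇒≤ n<m)) (q>n m n<m) }
    where
    -- At indices above n the summand -aq contributes nothing, so there the product is q moved up by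
    -- one place.
    top : ∀ m → n ≤ m → coeff (mulLinear a q) (suc m) ≈ coeff q m
    top m n≤m = begin
      coeff (mulLinear a q) (suc m)        ≈⟨ coeff-mulLinear a q (suc m) ⟩
      - a * coeff q (suc m) + coeff q m    ≈⟨ +-congʳ (*-congˡ (q>n (suc m) (s≤s n≤m))) ⟩
      - a * 0# + coeff q m                 ≈⟨ +-congʳ (zeroʳ _) ⟩
      0# + coeff q m                       ≈⟨ +-identityˡ _ ⟩
      coeff q m                            ∎

  HasDegree-mulLinearPow : ∀ a m q {n} → HasDegree q n → HasDegree (mulLinearPow a m q) (m ℕ.+ n)
  HasDegree-mulLinearPow a zero    q deg = deg
  HasDegree-mulLinearPow a (suc m) q deg = HasDegree-mulLinear a (mulLinearPow a m q) (HasDegree-mulLinearPow a m q deg)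

  -- Synthetic division: the coefficients of (p - p(a)) / (X - a) are the Horner values at a of the
  -- nonempty proper tails of p.
  quotient : Carrier → Polynomial → Polynomial
  quotient a []          = []
  quotient a (b ∷ [])    = []
  quotient a (b ∷ c ∷ p) = eval (c ∷ p) a ∷ quotient a (c ∷ p)

  -- The measure for recursions that repeatedly divide out a root: the quotient is not a sublist of
  -- the dividend, but it is shorter.
  length-quotient : ∀ a b p → length (quotient a (b ∷ p)) ≡ length p
  length-quotient a b []      = ≡.refl
  length-quotient a b (c ∷ p) = ≡.cong suc (length-quotient a c p)

  -- Division with remainder p(a). It rests on Horner's recurrence: the value of `b ∷ p` at a is b
  -- plus a times the value of its tail.
  quotient-coeff : ∀ a p n →
    coeff p n ≈ coeff (mulLinear a (quotient a p)) n + coeff (constant (eval p a)) n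
  quotient-coeff a p n = trans (step p n) (+-congʳ (sym (coeff-mulLinear a (quotient a p) n)))
    where
    step : ∀ p n → coeff p n ≈ (- a * coeff (quotient a p) n + coeff (0# ∷ quotient a p) n)
                               + coeff (constant (eval p a)) n
    step [] zero = sym (trans (+-identityʳ _) (trans (+-identityʳ _) (zeroʳ _)))
    step [] (suc n) = sym (trans (+-identityʳ _) (trans (+-identityʳ _) (zeroʳ _)))
    step (b ∷ []) zero = begin
      b                              ≈⟨ +-identityʳ b ⟨
      b + 0#                         ≈⟨ +-congˡ (zeroʳ a) ⟨
      b + a * 0#                     ≈⟨ +-identityˡ _ ⟨
      0# + (b + a * 0#)              ≈⟨ +-congʳ (trans (+-identityʳ _) (zeroʳ _)) ⟨
      (- a * 0# + 0#) + (b + a * 0#) ∎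
    step (b ∷ []) (suc n) = sym (trans (+-identityʳ _) (trans (+-identityʳ _) (zeroʳ _)))
    step (b ∷ c ∷ p) zero = begin
      b                              ≈⟨ +-identityˡ b ⟨
      0# + b                         ≈⟨ +-congʳ (-‿inverseˡ _) ⟨
      (- (a * e) + a * e) + b        ≈⟨ +-assoc _ _ _ ⟩
      - (a * e) + (a * e + b)        ≈⟨ +-cong (trans (-‿distribˡ-* a e) (sym (+-identityʳ _))) (+-comm _ _) ⟩
      (- a * e + 0#) + (b + a * e)   ∎
      where e = eval (c ∷ p) a
    -- The remainder on dividing the tail `c ∷ p` is the lowest coefficient of the new quotient, so
    -- it moves from the remainder term to the shifted one.
    step (b ∷ c ∷ p) (suc zero) = begin
      c                            ≈⟨ step (c ∷ p) 0 ⟩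
      (- a * coeff (quotient a (c ∷ p)) 0 + 0#) + eval (c ∷ p) a ≈⟨ +-congʳ (+-identityʳ _) ⟩
      - a * coeff (quotient a (c ∷ p)) 0 + eval (c ∷ p) a ≈⟨ +-identityʳ _ ⟨
      - a * coeff (quotient a (c ∷ p)) 0 + eval (c ∷ p) a + 0# ∎
    step (b ∷ c ∷ p) (suc (suc n)) = step (c ∷ p) (suc n)

  -- The factor theorem: at a root the remainder vanishes.
  root⇒mulLinear : ∀ a p → eval p a ≈ 0# → p ≈ₚ mulLinear a (quotient a p)
  root⇒mulLinear a p root n =
    trans (quotient-coeff a p n) (trans (+-congˡ (remainder≈0 n)) (+-identityʳ _))
    where
    remainder≈0 : ∀ n → coeff (constant (eval p a)) n ≈ 0#
    remainder≈0 zero    = root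
    remainder≈0 (suc n) = refl

-- Evaluation and differentiation along a ring homomorphism.

module Evaluation {c ℓ c′ ℓ′ : Level} (R : CommutativeRing c ℓ) (S : CommutativeRing c′ ℓ′)
                  (f : CommutativeRing.Carrier R → CommutativeRing.Carrier S)
                  (f-isHom : IsRingHom R S f) where
  private
    module R = CommutativeRing R
    module Hom = RingMorphisms.IsRingHomomorphism f-isHom
    module RMult = SemiringMult R.semiring
    module SCoeff = Coefficients S
    infixr 8 _R·_
    _R·_ = RMult._×_
  open CommutativeRing S
  open Poly R
  open Coefficients R
  open SemiringMult semiring using (×-assoc-*; ×-comm-*; ×-homo-1) renaming (_×_ to _·_)
  open MonoidMult +-commutativeMonoid using (×-distrib-+)
  open SemiringExp semiring using (_^_; ^-congˡ)
  open SemiringSum semiring using (sum; sum-cong-≋; *-distribˡ-sum)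
  open SemiringSolver commutativeSemiring using (solve; _:=_; _:+_; _:*_)
  open SetoidReasoning setoid

  -- One treatment serves three homomorphisms: the identity of a field, `fromℚ` into K, and `embed`
  -- into the algebraic closure.
  evalVia : Polynomial → Carrier → Carrier
  evalVia p x = foldr (λ a r → f a + x * r) 0# p

  evalVia-map : ∀ p x → evalVia p x ≡ Poly.eval S (map f p) x
  evalVia-map []      x = ≡.refl
  evalVia-map (a ∷ p) x = ≡.cong (λ r → f a + x * r) (evalVia-map p x)

  coeff-map : ∀ p n → Poly.coeff S (map f p) n ≈ f (coeff p n)
  coeff-map []      n       = sym Hom.0#-homo
  coeff-map (a ∷ p) zero    = refl
  coeff-map (a ∷ p) (suc n) = coeff-map p n

  ·-homo : ∀ n a → f (n RMult.× a) ≈ n · f a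
  ·-homo zero    a = Hom.0#-homo
  ·-homo (suc n) a = trans (Hom.+-homo _ _) (+-congˡ (·-homo n a))

  -- Equal polynomials may be lists of different lengths; the cases with one empty list show that
  -- trailing zeros contribute nothing.
  evalVia-cong : ∀ p q {x y} → p ≈ₚ q → x ≈ y → evalVia p x ≈ evalVia q y
  evalVia-cong [] [] p≈q x≈y = refl
  evalVia-cong [] (b ∷ q) {x} {y} p≈q x≈y = begin
    0#                     ≈⟨ +-identityʳ _ ⟨
    0# + 0#                ≈⟨ +-cong (trans (sym Hom.0#-homo) (Hom.⟦⟧-cong (p≈q 0))) (sym (zeroʳ y)) ⟩
    f b + y * 0#           ≈⟨ +-congˡ (*-congˡ (evalVia-cong [] q (p≈q ∘ suc) x≈y)) ⟩
    f b + y * evalVia q y  ∎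
  evalVia-cong (a ∷ p) [] {x} {y} p≈q x≈y = begin
    f a + x * evalVia p x  ≈⟨ +-cong (trans (Hom.⟦⟧-cong (p≈q 0)) Hom.0#-homo)
                                     (*-congˡ (evalVia-cong p [] (p≈q ∘ suc) x≈y)) ⟩
    0# + x * 0#            ≈⟨ +-congˡ (zeroʳ x) ⟩
    0# + 0#                ≈⟨ +-identityʳ _ ⟩
    0#                     ∎
  evalVia-cong (a ∷ p) (b ∷ q) p≈q x≈y =
    +-cong (Hom.⟦⟧-cong (p≈q 0)) (*-cong x≈y (evalVia-cong p q (p≈q ∘ suc) x≈y))

  evalVia-f : ∀ p a → evalVia p (f a) ≈ f (eval p a)
  evalVia-f []      a = sym Hom.0#-homo
  evalVia-f (b ∷ p) a = begin
    f b + f a * evalVia p (f a)  ≈⟨ +-congˡ (*-congˡ (evalVia-f p a)) ⟩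
    f b + f a * f (eval p a)     ≈⟨ +-congˡ (Hom.*-homo a (eval p a)) ⟨
    f b + f (a R.* eval p a)     ≈⟨ Hom.+-homo b (a R.* eval p a) ⟨
    f (b R.+ a R.* eval p a)     ∎

  evalVia-constant : ∀ a x → evalVia (constant a) x ≈ f a
  evalVia-constant a x = trans (+-congˡ (zeroʳ x)) (+-identityʳ _)

  evalVia-+ₚ : ∀ p q x → evalVia (p +ₚ q) x ≈ evalVia p x + evalVia q x
  evalVia-+ₚ []      q       x = sym (+-identityˡ _)
  evalVia-+ₚ (a ∷ p) []      x = sym (+-identityʳ _)
  evalVia-+ₚ (a ∷ p) (b ∷ q) x = begin
    f (a R.+ b) + x * evalVia (p +ₚ q) x  ≈⟨ +-cong (Hom.+-homo a b) (*-congˡ (evalVia-+ₚ p q x)) ⟩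
    (f a + f b) + x * (P + Q)
      ≈⟨ solve 5 (λ a b x p q → (a :+ b) :+ x :* (p :+ q) := (a :+ x :* p) :+ (b :+ x :* q)) refl (f a) (f b) x P Q ⟩
    (f a + x * P) + (f b + x * Q)         ∎
    where
    P = evalVia p x
    Q = evalVia q x

  evalVia-• : ∀ a p x → evalVia (a • p) x ≈ f a * evalVia p x
  evalVia-• a []      x = sym (zeroʳ _)
  evalVia-• a (b ∷ p) x = begin
    f (a R.* b) + x * evalVia (a • p) x    ≈⟨ +-cong (Hom.*-homo a b) (*-congˡ (evalVia-• a p x)) ⟩
    f a * f b + x * (f a * evalVia p x)
      ≈⟨ solve 4 (λ a b x p → a :* b :+ x :* (a :* p) := a :* (b :+ x :* p)) refl (f a) (f b) x (evalVia p x) ⟩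
    f a * (f b + x * evalVia p x)          ∎

  evalVia-0∷ : ∀ p x → evalVia (R.0# ∷ p) x ≈ x * evalVia p x
  evalVia-0∷ p x = trans (+-congʳ Hom.0#-homo) (+-identityˡ _)

  evalVia-X : ∀ x → evalVia X x ≈ x
  evalVia-X x = begin
    f R.0# + x * (f R.1# + x * 0#)  ≈⟨ evalVia-0∷ (R.1# ∷ []) x ⟩
    x * (f R.1# + x * 0#)           ≈⟨ *-congˡ (evalVia-constant R.1# x) ⟩
    x * f R.1#                      ≈⟨ *-congˡ Hom.1#-homo ⟩
    x * 1#                          ≈⟨ *-identityʳ x ⟩
    x                               ∎

  evalVia-*ₚ : ∀ p q x → evalVia (p *ₚ q) x ≈ evalVia p x * evalVia q x
  evalVia-*ₚ []      q x = sym (zeroˡ _)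
  evalVia-*ₚ (a ∷ p) q x = begin
    evalVia (a • q +ₚ (R.0# ∷ p *ₚ q)) x              ≈⟨ evalVia-+ₚ (a • q) _ x ⟩
    evalVia (a • q) x + evalVia (R.0# ∷ p *ₚ q) x     ≈⟨ +-cong (evalVia-• a q x) (evalVia-0∷ (p *ₚ q) x) ⟩
    f a * Q + x * evalVia (p *ₚ q) x                  ≈⟨ +-congˡ (*-congˡ (evalVia-*ₚ p q x)) ⟩
    f a * Q + x * (P * Q)
      ≈⟨ solve 4 (λ a x p q → a :* q :+ x :* (p :* q) := (a :+ x :* p) :* q) refl (f a) x P Q ⟩
    (f a + x * P) * Q                                 ∎
    where
    P = evalVia p x
    Q = evalVia q x

  evalVia-^ₚ : ∀ p n x → evalVia (p ^ₚ n) x ≈ evalVia p x ^ n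
  evalVia-^ₚ p zero    x = trans (evalVia-constant R.1# x) Hom.1#-homo
  evalVia-^ₚ p (suc n) x = trans (evalVia-*ₚ p (p ^ₚ n) x) (*-congˡ (evalVia-^ₚ p n x))

  evalVia-mulLinear : ∀ a q x → evalVia (mulLinear a q) x ≈ (x - f a) * evalVia q x
  evalVia-mulLinear a q x = begin
    evalVia ((R.- a) • q +ₚ (R.0# ∷ q)) x          ≈⟨ evalVia-+ₚ ((R.- a) • q) _ x ⟩
    evalVia ((R.- a) • q) x + evalVia (R.0# ∷ q) x ≈⟨ +-cong (evalVia-• (R.- a) q x) (evalVia-0∷ q x) ⟩
    f (R.- a) * evalVia q x + x * evalVia q x      ≈⟨ distribʳ _ _ _ ⟨
    (f (R.- a) + x) * evalVia q x                  ≈⟨ *-congʳ (+-comm _ _) ⟩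
    (x + f (R.- a)) * evalVia q x                  ≈⟨ *-congʳ (+-congˡ (Hom.-‿homo a)) ⟩
    (x - f a) * evalVia q x                        ∎

  evalVia-mulLinearPow : ∀ a m q x → evalVia (mulLinearPow a m q) x ≈ (x - f a) ^ m * evalVia q x
  evalVia-mulLinearPow a zero    q x = sym (*-identityˡ _)
  evalVia-mulLinearPow a (suc m) q x = begin
    evalVia (mulLinear a (mulLinearPow a m q)) x  ≈⟨ evalVia-mulLinear a (mulLinearPow a m q) x ⟩
    (x - f a) * evalVia (mulLinearPow a m q) x    ≈⟨ *-congˡ (evalVia-mulLinearPow a m q x) ⟩
    (x - f a) * ((x - f a) ^ m * evalVia q x)     ≈⟨ *-assoc _ _ _ ⟨
    (x - f a) ^ suc m * evalVia q x               ∎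

  derivVia : Polynomial → Carrier → Carrier
  derivVia p x = evalVia (deriv p) x

  -- The weight i + n on coefficient n splits into i, which gives i copies of p(x), and n, which
  -- gives x p′(x).
  evalVia-derivFrom : ∀ i p x → evalVia (derivFrom i p) x ≈ i · evalVia p x + x * derivVia p x
  evalVia-derivFrom i p x = begin
    evalVia (derivFrom i p) x                                 ≈⟨ shift i p ⟩
    i · evalVia p x + evalVia (derivFrom 0 p) x               ≈⟨ +-congˡ (from-zero p) ⟩
    i · evalVia p x + x * derivVia p x                        ∎
    where
    shift : ∀ i p → evalVia (derivFrom i p) x ≈ i · evalVia p x + evalVia (derivFrom 0 p) x
    shift i []      = trans (sym (SCoeff.·-zeroʳ i)) (sym (+-identityʳ _))
    shift i (a ∷ p) = begin
      f (i R· a) + x * evalVia (derivFrom (suc i) p) x  ≈⟨ +-cong (·-homo i a) (*-congˡ (shift (suc i) p)) ⟩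
      i · f a + x * ((P + i · P) + Z)
        ≈⟨ solve 5 (λ a x p ip z → a :+ x :* ((p :+ ip) :+ z) := (a :+ x :* ip) :+ x :* (p :+ z)) refl (i · f a) x P (i · P) Z ⟩
      (i · f a + x * (i · P)) + x * (P + Z)
        ≈⟨ +-cong (+-congˡ (×-comm-* i x P)) (*-congˡ (+-congʳ (sym (×-homo-1 P)))) ⟩
      (i · f a + i · (x * P)) + x * (1 · P + Z)
        -- The induction hypothesis is used a second time, at weight 1, since the weights of
        -- `derivFrom 0 (a ∷ p)` start at 1 on the tail.
        ≈⟨ +-cong (sym (×-distrib-+ _ _ i)) (*-congˡ (sym (shift 1 p))) ⟩
      i · (f a + x * P) + x * evalVia (derivFrom 1 p) x  ≈⟨ +-congˡ (evalVia-0∷ (derivFrom 1 p) x) ⟨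
      i · (f a + x * P) + evalVia (derivFrom 0 (a ∷ p)) x ∎
      where
      P = evalVia p x
      Z = evalVia (derivFrom 0 p) x
    from-zero : ∀ p → evalVia (derivFrom 0 p) x ≈ x * derivVia p x
    from-zero []      = sym (zeroʳ x)
    from-zero (a ∷ p) = evalVia-0∷ (derivFrom 1 p) x

  -- The derivative of a + Xp is p + Xp′. The rules for sums, scalar multiples, products and
  -- compositions below are inductions through this identity.
  derivVia-∷ : ∀ a p x → derivVia (a ∷ p) x ≈ evalVia p x + x * derivVia p x
  derivVia-∷ a p x = trans (evalVia-derivFrom 1 p x) (+-congʳ (×-homo-1 _))

  derivVia-+ₚ : ∀ p q x → derivVia (p +ₚ q) x ≈ derivVia p x + derivVia q x
  derivVia-+ₚ []      q       x = sym (+-identityˡ _)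
  derivVia-+ₚ (a ∷ p) []      x = sym (+-identityʳ _)
  derivVia-+ₚ (a ∷ p) (b ∷ q) x = begin
    derivVia (a R.+ b ∷ p +ₚ q) x                        ≈⟨ derivVia-∷ (a R.+ b) (p +ₚ q) x ⟩
    evalVia (p +ₚ q) x + x * derivVia (p +ₚ q) x         ≈⟨ +-cong (evalVia-+ₚ p q x) (*-congˡ (derivVia-+ₚ p q x)) ⟩
    (evalVia p x + evalVia q x) + x * (derivVia p x + derivVia q x)
      ≈⟨ solve 5 (λ x p q p′ q′ → (p :+ q) :+ x :* (p′ :+ q′) := (p :+ x :* p′) :+ (q :+ x :* q′)) refl
           x (evalVia p x) (evalVia q x) (derivVia p x) (derivVia q x) ⟩
    (evalVia p x + x * derivVia p x) + (evalVia q x + x * derivVia q x)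
      ≈⟨ +-cong (derivVia-∷ a p x) (derivVia-∷ b q x) ⟨
    derivVia (a ∷ p) x + derivVia (b ∷ q) x              ∎

  derivVia-• : ∀ a p x → derivVia (a • p) x ≈ f a * derivVia p x
  derivVia-• a []      x = sym (zeroʳ _)
  derivVia-• a (b ∷ p) x = begin
    derivVia (a R.* b ∷ a • p) x                     ≈⟨ derivVia-∷ (a R.* b) (a • p) x ⟩
    evalVia (a • p) x + x * derivVia (a • p) x       ≈⟨ +-cong (evalVia-• a p x) (*-congˡ (derivVia-• a p x)) ⟩
    f a * evalVia p x + x * (f a * derivVia p x)
      ≈⟨ solve 4 (λ a x p p′ → a :* p :+ x :* (a :* p′) := a :* (p :+ x :* p′)) refl (f a) x (evalVia p x) (derivVia p x) ⟩
    f a * (evalVia p x + x * derivVia p x)           ≈⟨ *-congˡ (derivVia-∷ b p x) ⟨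
    f a * derivVia (b ∷ p) x                         ∎

  derivVia-*ₚ : ∀ p q x → derivVia (p *ₚ q) x ≈ derivVia p x * evalVia q x + evalVia p x * derivVia q x
  derivVia-*ₚ []      q x = sym (trans (+-cong (zeroˡ _) (zeroˡ _)) (+-identityʳ _))
  derivVia-*ₚ (a ∷ p) q x = begin
    derivVia (a • q +ₚ (R.0# ∷ p *ₚ q)) x                    ≈⟨ derivVia-+ₚ (a • q) _ x ⟩
    derivVia (a • q) x + derivVia (R.0# ∷ p *ₚ q) x
      ≈⟨ +-cong (derivVia-• a q x) (derivVia-∷ R.0# (p *ₚ q) x) ⟩
    f a * Q′ + (evalVia (p *ₚ q) x + x * derivVia (p *ₚ q) x)
      ≈⟨ +-congˡ (+-cong (evalVia-*ₚ p q x) (*-congˡ (derivVia-*ₚ p q x))) ⟩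
    f a * Q′ + (P * Q + x * (P′ * Q + P * Q′))
      ≈⟨ solve 6 (λ a x p p′ q q′ → a :* q′ :+ (p :* q :+ x :* (p′ :* q :+ p :* q′))
                                    := (p :+ x :* p′) :* q :+ (a :+ x :* p) :* q′) refl (f a) x P P′ Q Q′ ⟩
    (P + x * P′) * Q + (f a + x * P) * Q′                    ≈⟨ +-congʳ (*-congʳ (derivVia-∷ a p x)) ⟨
    derivVia (a ∷ p) x * Q + (f a + x * P) * Q′              ∎
    where
    P  = evalVia p x
    P′ = derivVia p x
    Q  = evalVia q x
    Q′ = derivVia q x

  evalVia-∘ₚ : ∀ p q x → evalVia (p ∘ₚ q) x ≈ evalVia p (evalVia q x)
  evalVia-∘ₚ []      q x = refl
  evalVia-∘ₚ (a ∷ p) q x = begin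
    evalVia (constant a +ₚ q *ₚ p ∘ₚ q) x               ≈⟨ evalVia-+ₚ (constant a) (q *ₚ p ∘ₚ q) x ⟩
    evalVia (constant a) x + evalVia (q *ₚ p ∘ₚ q) x    ≈⟨ +-cong (evalVia-constant a x) (evalVia-*ₚ q (p ∘ₚ q) x) ⟩
    f a + evalVia q x * evalVia (p ∘ₚ q) x              ≈⟨ +-congˡ (*-congˡ (evalVia-∘ₚ p q x)) ⟩
    f a + evalVia q x * evalVia p (evalVia q x)         ∎

  -- The chain rule: the product rule applied to the Horner form `constant a +ₚ q *ₚ p ∘ₚ q`.
  derivVia-∘ₚ : ∀ p q x → derivVia (p ∘ₚ q) x ≈ derivVia p (evalVia q x) * derivVia q x
  derivVia-∘ₚ []      q x = sym (zeroˡ _)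
  derivVia-∘ₚ (a ∷ p) q x = begin
    derivVia (constant a +ₚ q *ₚ p ∘ₚ q) x              ≈⟨ derivVia-+ₚ (constant a) (q *ₚ p ∘ₚ q) x ⟩
    0# + derivVia (q *ₚ p ∘ₚ q) x                       ≈⟨ +-identityˡ _ ⟩
    derivVia (q *ₚ p ∘ₚ q) x                            ≈⟨ derivVia-*ₚ q (p ∘ₚ q) x ⟩
    Q′ * evalVia (p ∘ₚ q) x + Q * derivVia (p ∘ₚ q) x
      ≈⟨ +-cong (*-congˡ (evalVia-∘ₚ p q x)) (*-congˡ (derivVia-∘ₚ p q x)) ⟩
    Q′ * P + Q * (P′ * Q′)
      ≈⟨ solve 4 (λ p p′ q q′ → q′ :* p :+ q :* (p′ :* q′) := (p :+ q :* p′) :* q′) refl P P′ Q Q′ ⟩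
    (P + Q * P′) * Q′                                   ≈⟨ *-congʳ (derivVia-∷ a p Q) ⟨
    derivVia (a ∷ p) Q * Q′                             ∎
    where
    Q  = evalVia q x
    Q′ = derivVia q x
    P  = evalVia p Q
    P′ = derivVia p Q

  derivVia-X : ∀ x → derivVia X x ≈ 1#
  derivVia-X x = trans (evalVia-cong (1 R· R.1# ∷ []) (constant R.1#) {x} {x}
                          (∷-cong (RMult.×-homo-1 R.1#) (λ _ → R.refl)) refl)
                       (trans (evalVia-constant R.1# x) Hom.1#-homo)

  derivVia-X^ₚ : ∀ m x → derivVia (X ^ₚ suc m) x ≈ suc m · x ^ m
  derivVia-X^ₚ m x = begin
    derivVia (X *ₚ X ^ₚ m) x                                        ≈⟨ derivVia-*ₚ X (X ^ₚ m) x ⟩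
    derivVia X x * evalVia (X ^ₚ m) x + evalVia X x * derivVia (X ^ₚ m) x
      ≈⟨ +-cong (*-cong (derivVia-X x) (trans (evalVia-^ₚ X m x) (^-congˡ m (evalVia-X x)))) (*-congʳ (evalVia-X x)) ⟩
    1# * x ^ m + x * derivVia (X ^ₚ m) x                            ≈⟨ +-cong (*-identityˡ _) (power m) ⟩
    x ^ m + m · x ^ m                                               ∎
    where
    -- The extra factor x keeps the exponent at m, so that no predecessor of m is needed.
    power : ∀ m → x * derivVia (X ^ₚ m) x ≈ m · x ^ m
    power zero    = zeroʳ x
    power (suc m) = trans (*-congˡ (derivVia-X^ₚ m x)) (×-comm-* (suc m) x (x ^ m))

  -- The derivative of X^(m+1) q is X^m times ((m+1) q + X q′), and the bracket multiplies
  -- coefficient j of q by m + 1 + j. For `𝓑` these weights are exactly the denominators.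
  derivVia-X^*ₚ : ∀ m q x → derivVia (X ^ₚ suc m *ₚ q) x ≈ x ^ m * evalVia (derivFrom (suc m) q) x
  derivVia-X^*ₚ m q x = begin
    derivVia (X ^ₚ suc m *ₚ q) x                                         ≈⟨ derivVia-*ₚ (X ^ₚ suc m) q x ⟩
    derivVia (X ^ₚ suc m) x * Q + evalVia (X ^ₚ suc m) x * Q′
      ≈⟨ +-cong (*-congʳ (derivVia-X^ₚ m x)) (*-congʳ (trans (evalVia-^ₚ X (suc m) x) (^-congˡ (suc m) (evalVia-X x)))) ⟩
    (suc m · x ^ m) * Q + (x * x ^ m) * Q′
      ≈⟨ +-congʳ (trans (×-assoc-* (suc m) (x ^ m) Q) (sym (×-comm-* (suc m) (x ^ m) Q))) ⟩
    x ^ m * (suc m · Q) + (x * x ^ m) * Q′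
      ≈⟨ solve 4 (λ xm mq x q′ → xm :* mq :+ (x :* xm) :* q′ := xm :* (mq :+ x :* q′)) refl (x ^ m) (suc m · Q) x Q′ ⟩
    x ^ m * (suc m · Q + x * Q′)                                         ≈⟨ *-congˡ (evalVia-derivFrom (suc m) q x) ⟨
    x ^ m * evalVia (derivFrom (suc m) q) x                              ∎
    where
    Q  = evalVia q x
    Q′ = derivVia q x

  -- Brings the value into the form of an indexed sum, to which the binomial theorem applies.
  evalVia-derivFrom-applyUpTo : ∀ i u n x →
    evalVia (derivFrom i (applyUpTo u n)) x ≈ sum {n} (λ j → f ((i ℕ.+ toℕ j) R· u (toℕ j)) * x ^ toℕ j)
  evalVia-derivFrom-applyUpTo i u zero    x = refl
  evalVia-derivFrom-applyUpTo i u (suc n) x = begin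
    f (i R· u 0) + x * evalVia (derivFrom (suc i) (applyUpTo (u ∘ suc) n)) x
      ≈⟨ +-cong (trans (Hom.⟦⟧-cong (RMult.×-congˡ (≡.sym (ℕₚ.+-identityʳ i)))) (sym (*-identityʳ _)))
                (*-congˡ (evalVia-derivFrom-applyUpTo (suc i) (u ∘ suc) n x)) ⟩
    f ((i ℕ.+ 0) R· u 0) * 1# + x * sum {n} (λ j → f ((suc i ℕ.+ toℕ j) R· u (suc (toℕ j))) * x ^ toℕ j)
      ≈⟨ +-congˡ (*-distribˡ-sum {n} x _) ⟩
    f ((i ℕ.+ 0) R· u 0) * 1# + sum {n} (λ j → x * (f ((suc i ℕ.+ toℕ j) R· u (suc (toℕ j))) * x ^ toℕ j))
      ≈⟨ +-congˡ (sum-cong-≋ {n} λ j → trans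
           (solve 3 (λ x a p → x :* (a :* p) := a :* (x :* p)) refl x (f ((suc i ℕ.+ toℕ j) R· u (suc (toℕ j)))) (x ^ toℕ j))
           (*-congʳ (Hom.⟦⟧-cong (RMult.×-congˡ (≡.sym (ℕₚ.+-suc i (toℕ j))))))) ⟩
    f ((i ℕ.+ 0) R· u 0) * 1# + sum {n} (λ j → f ((i ℕ.+ suc (toℕ j)) R· u (suc (toℕ j))) * (x * x ^ toℕ j)) ∎

-- Cancellation in fields.

module FieldProperties {c ℓ : Level} (K : Field c ℓ) where
  open Field K
  open SemiringMult semiring using () renaming (_×_ to _·_)
  open SemiringExp semiring using (_^_)
  open SetoidReasoning setoid

  -- Characteristic zero, in the form that cancels the factor n + 1 which differentiation puts on a
  -- coefficient.
  TorsionFree : Set (c ⊔ ℓ)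
  TorsionFree = ∀ n x → suc n · x ≈ 0# → x ≈ 0#

  x*y≈0⇒y≈0 : ∀ {x y} → ¬ (x ≈ 0#) → x * y ≈ 0# → y ≈ 0#
  x*y≈0⇒y≈0 {x} {y} x≉0 xy≈0 with x⁻¹ , x⁻¹x≈1 , _ ← invertible x x≉0 = begin
    y              ≈⟨ *-identityˡ y ⟨
    1# * y         ≈⟨ *-congʳ x⁻¹x≈1 ⟨
    (x⁻¹ * x) * y  ≈⟨ *-assoc _ _ _ ⟩
    x⁻¹ * (x * y)  ≈⟨ *-congˡ xy≈0 ⟩
    x⁻¹ * 0#       ≈⟨ zeroʳ x⁻¹ ⟩
    0#             ∎

  x^n≉0 : ∀ {x} n → ¬ (x ≈ 0#) → ¬ (x ^ n ≈ 0#)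
  x^n≉0 zero    x≉0 1≈0  = 0≉1 (sym 1≈0)
  x^n≉0 (suc n) x≉0 xⁿ≈0 = x^n≉0 n x≉0 (x*y≈0⇒y≈0 x≉0 xⁿ≈0)

  open Evaluation commutativeRing commutativeRing id (Identity.isRingHomomorphism rawRing refl) public
    using () renaming
    ( evalVia-cong to eval-cong; evalVia-constant to eval-constant
    ; evalVia-+ₚ to eval-+ₚ; evalVia-• to eval-•; evalVia-X to eval-X; evalVia-mulLinear to eval-mulLinear
    ; evalVia-mulLinearPow to eval-mulLinearPow; derivVia-+ₚ to eval-deriv-+ₚ
    ; derivVia-• to eval-deriv-•; derivVia-X to eval-deriv-X; derivVia-∘ₚ to eval-deriv-∘ₚ )

-- Polynomials over a field of characteristic zero.

module CharacteristicZero {c ℓ : Level} (K : Field c ℓ)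
                          (torsionFree : FieldProperties.TorsionFree K) where
  open Field K
  open FieldProperties K
  open Coefficients commutativeRing
  open SemiringMult semiring using (×-congˡ; ×-congʳ; ×-homo-+) renaming (_×_ to _·_)
  open MonoidMult +-commutativeMonoid using (×-distrib-+)
  open RingProperties ring using (x∙y⁻¹≈ε⇒x≈y; -1*x≈-x; xyx⁻¹≈y)
  open SetoidReasoning setoid

  ·-cancelˡ : ∀ n {x y} → suc n · x ≈ suc n · y → x ≈ y
  ·-cancelˡ n {x} {y} nx≈ny = x∙y⁻¹≈ε⇒x≈y x y (torsionFree n _ (begin
    suc n · (x - y)             ≈⟨ ×-distrib-+ x (- y) (suc n) ⟩
    suc n · x + suc n · (- y)   ≈⟨ +-congʳ nx≈ny ⟩
    suc n · y + suc n · (- y)   ≈⟨ ×-distrib-+ y (- y) (suc n) ⟨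
    suc n · (y - y)             ≈⟨ ×-congʳ (suc n) (-‿inverseʳ y) ⟩
    suc n · 0#                  ≈⟨ ·-zeroʳ (suc n) ⟩
    0#                          ∎))

  -- Divide by X - j. In characteristic zero the later points j + 1, j + 2, ... differ from j, so
  -- the quotient vanishes at all of them, and induction on the length n applies with j + 1 in place
  -- of j.
  ≈[]-if-vanishing : ∀ n j p → length p ≡ n → (∀ i → eval p ((j ℕ.+ i) · 1#) ≈ 0#) → p ≈ₚ []
  ≈[]-if-vanishing n       j []      |p|≡n vanishing = λ _ → refl
  ≈[]-if-vanishing (suc n) j (a ∷ p) |p|≡n vanishing i = begin
    coeff (a ∷ p) i                          ≈⟨ p≈ i ⟩
    coeff (mulLinear x₀ q) i                 ≈⟨ mulLinear-≈[] x₀ q q≈[] i ⟩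
    0#                                       ∎
    where
    x₀ = j · 1#
    q  = quotient x₀ (a ∷ p)
    p≈ : (a ∷ p) ≈ₚ mulLinear x₀ q
    p≈ = root⇒mulLinear x₀ (a ∷ p)
           (trans (eval-cong (a ∷ p) (a ∷ p) (λ _ → refl) (×-congˡ (≡.sym (ℕₚ.+-identityʳ j)))) (vanishing 0))
    q≈[] : q ≈ₚ []
    q≈[] = ≈[]-if-vanishing n (suc j) q (≡.trans (length-quotient x₀ a p) (ℕₚ.suc-injective |p|≡n)) λ i →
      let x = (suc j ℕ.+ i) · 1# in
      x*y≈0⇒y≈0 {x - x₀} (λ x-x₀≈0 → 0≉1 (sym (torsionFree i 1# (begin
          suc i · 1#                  ≈⟨ xyx⁻¹≈y x₀ (suc i · 1#) ⟨
          x₀ + suc i · 1# - x₀        ≈⟨ +-congʳ (×-homo-+ 1# j (suc i)) ⟨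
          (j ℕ.+ suc i) · 1# - x₀     ≈⟨ +-congʳ (×-congˡ (ℕₚ.+-suc j i)) ⟩
          x - x₀                      ≈⟨ x-x₀≈0 ⟩
          0#                          ∎))))
        (begin
          (x - x₀) * eval q x         ≈⟨ eval-mulLinear x₀ q x ⟨
          eval (mulLinear x₀ q) x     ≈⟨ eval-cong (a ∷ p) (mulLinear x₀ q) p≈ refl ⟨
          eval (a ∷ p) x              ≈⟨ eval-cong (a ∷ p) (a ∷ p) (λ _ → refl) (×-congˡ (ℕₚ.+-suc j i)) ⟨
          eval (a ∷ p) ((j ℕ.+ suc i) · 1#) ≈⟨ vanishing (suc i) ⟩
          0#                          ∎)

  -- The difference p - q vanishes at 0, 1, 2, ..., which are distinct points in characteristic
  -- zero.
  eval-injective : ∀ p q → (∀ x → eval p x ≈ eval q x) → p ≈ₚ q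
  eval-injective p q p≗q n = x∙y⁻¹≈ε⇒x≈y _ _ (begin
    coeff p n - coeff q n                   ≈⟨ +-congˡ (-1*x≈-x _) ⟨
    coeff p n + - 1# * coeff q n            ≈⟨ +-congˡ (coeff-• (- 1#) q n) ⟨
    coeff p n + coeff ((- 1#) • q) n        ≈⟨ coeff-+ₚ p _ n ⟨
    coeff (p +ₚ (- 1#) • q) n
      ≈⟨ ≈[]-if-vanishing _ 0 (p +ₚ (- 1#) • q) ≡.refl (λ i → vanishes (i · 1#)) n ⟩
    0#                                      ∎)
    where
    vanishes : ∀ x → eval (p +ₚ (- 1#) • q) x ≈ 0#
    vanishes x = begin
      eval (p +ₚ (- 1#) • q) x              ≈⟨ eval-+ₚ p _ x ⟩
      eval p x + eval ((- 1#) • q) x        ≈⟨ +-congˡ (eval-• (- 1#) q x) ⟩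
      eval p x + - 1# * eval q x            ≈⟨ +-cong (p≗q x) (-1*x≈-x _) ⟩
      eval q x - eval q x                   ≈⟨ -‿inverseʳ _ ⟩
      0#                                    ∎

  -- Coefficient n of a derivative is n + 1 times coefficient n + 1, and the integer factor cancels.
  -- The constant terms stay unrelated.
  deriv-injective : ∀ p q → deriv p ≈ₚ deriv q → ∀ n → coeff p (suc n) ≈ coeff q (suc n)
  deriv-injective p q p′≈q′ n = ·-cancelˡ n
    (trans (sym (coeff-deriv p n)) (trans (p′≈q′ n) (coeff-deriv q n)))

  HasDegree-deriv : ∀ p {n} → HasDegree p (suc n) → HasDegree (deriv p) n
  HasDegree-deriv p {n} (pₙ≉0 , p>n) =
    (λ ≈0 → pₙ≉0 (torsionFree n _ (trans (sym (coeff-deriv p n)) ≈0))) ,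
    λ m n<m → trans (coeff-deriv p m) (trans (×-congʳ (suc m) (p>n (suc m) (s≤s n<m))) (·-zeroʳ (suc m)))

-- Degrees and root multiplicities over a field with decidable equality.

module DecidableField {c ℓ : Level} (K : Field c ℓ)
                      (_≈0? : ∀ x → Dec (Field._≈_ K x (Field.0# K))) where
  open Field K
  open FieldProperties K
  open Coefficients commutativeRing

  -- Trailing zeros hide the degree; testing the coefficients from the top down finds the last
  -- nonzero one.
  degree? : ∀ p → p ≈ₚ [] ⊎ ∃ (HasDegree p)
  degree? [] = inj₁ λ _ → refl
  degree? (a ∷ p) with degree? p
  ... | inj₂ (n , pₙ≉0 , p>n) = inj₂ (suc n , pₙ≉0 , λ { (suc m) (s≤s n<m) → p>n m n<m })
  ... | inj₁ p≈[] with a ≈0?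
  ...   | yes a≈0 = inj₁ λ { zero → a≈0; (suc n) → p≈[] n }
  ...   | no  a≉0 = inj₂ (0 , a≉0 , λ { (suc m) _ → p≈[] m })

  -- Divide by X - a as long as a is a root. The list gets shorter each time, and the number of
  -- divisions m is the multiplicity of a.
  splitRoot : ∀ a p → ¬ (p ≈ₚ []) → ∃ λ m → ∃ λ q → p ≈ₚ mulLinearPow a m q × ¬ (eval q a ≈ 0#)
  splitRoot a p = go (length p) p ≡.refl
    where
    go : ∀ n p → length p ≡ n → ¬ (p ≈ₚ []) → ∃ λ m → ∃ λ q → p ≈ₚ mulLinearPow a m q × ¬ (eval q a ≈ 0#)
    go n       []      |p|≡n p≉[] = contradiction (λ _ → refl) p≉[]
    go (suc n) (b ∷ p) |p|≡n p≉[] with eval (b ∷ p) a ≈0?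
    ... | no  p[a]≉0 = 0 , b ∷ p , (λ _ → refl) , p[a]≉0
    ... | yes p[a]≈0 with go n (quotient a (b ∷ p)) (≡.trans (length-quotient a b p) (ℕₚ.suc-injective |p|≡n)) q≉[]
      where
      q≉[] : ¬ (quotient a (b ∷ p) ≈ₚ [])
      q≉[] q≈[] = p≉[] λ i → trans (root⇒mulLinear a (b ∷ p) p[a]≈0 i)
        (mulLinear-≈[] a (quotient a (b ∷ p)) q≈[] i)
    ...   | m , q , quot≈ , q[a]≉0 =
      suc m , q , (λ i → trans (root⇒mulLinear a (b ∷ p) p[a]≈0 i)
                             (mulLinear-cong a (quotient a (b ∷ p)) (mulLinearPow a m q) quot≈ i)) , q[a]≉0

  eval-HasDegree-0 : ∀ p x → HasDegree p 0 → eval p x ≈ coeff p 0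
  eval-HasDegree-0 p x (_ , p>0) = trans (eval-cong p (constant (coeff p 0)) p≈ refl) (eval-constant _ x)
    where
    p≈ : p ≈ₚ constant (coeff p 0)
    p≈ zero    = refl
    p≈ (suc n) = p>0 (suc n) (s≤s z≤n)

-- Arithmetic of fractions.

module Rational where
  open SemiringMult (CommutativeRing.semiring ℚₚ.+-*-commutativeRing) using () renaming (_×_ to _·_)
  open ℚᵘₚ.≃-Reasoning

  -- Rationals are kept in lowest terms, so the computation passes to unnormalised fractions, where
  -- no gcd intervenes.
  fromℚᵘ-homo-+ : ∀ p q → fromℚᵘ p ℚ.+ fromℚᵘ q ≡ fromℚᵘ (p ℚᵘ.+ q)
  fromℚᵘ-homo-+ p q = ℚₚ.toℚᵘ-injective (begin
    toℚᵘ (fromℚᵘ p ℚ.+ fromℚᵘ q)             ≈⟨ ℚₚ.toℚᵘ-homo-+ (fromℚᵘ p) (fromℚᵘ q) ⟩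
    toℚᵘ (fromℚᵘ p) ℚᵘ.+ toℚᵘ (fromℚᵘ q)     ≈⟨ ℚᵘₚ.+-cong (ℚₚ.toℚᵘ-fromℚᵘ p) (ℚₚ.toℚᵘ-fromℚᵘ q) ⟩
    p ℚᵘ.+ q                                 ≈⟨ ℚₚ.toℚᵘ-fromℚᵘ (p ℚᵘ.+ q) ⟨
    toℚᵘ (fromℚᵘ (p ℚᵘ.+ q))                 ∎)

  fromℚᵘ-homo-* : ∀ p q → fromℚᵘ p ℚ.* fromℚᵘ q ≡ fromℚᵘ (p ℚᵘ.* q)
  fromℚᵘ-homo-* p q = ℚₚ.toℚᵘ-injective (begin
    toℚᵘ (fromℚᵘ p ℚ.* fromℚᵘ q)             ≈⟨ ℚₚ.toℚᵘ-homo-* (fromℚᵘ p) (fromℚᵘ q) ⟩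
    toℚᵘ (fromℚᵘ p) ℚᵘ.* toℚᵘ (fromℚᵘ q)     ≈⟨ ℚᵘₚ.*-cong (ℚₚ.toℚᵘ-fromℚᵘ p) (ℚₚ.toℚᵘ-fromℚᵘ q) ⟩
    p ℚᵘ.* q                                 ≈⟨ ℚₚ.toℚᵘ-fromℚᵘ (p ℚᵘ.* q) ⟨
    toℚᵘ (fromℚᵘ (p ℚᵘ.* q))                 ∎)

  /1-homo-* : ∀ a b → (a ℤ.* b) ℚ./ 1 ≡ (a ℚ./ 1) ℚ.* (b ℚ./ 1)
  /1-homo-* a b = ≡.sym (fromℚᵘ-homo-* (mkℚᵘ a 0) (mkℚᵘ b 0))

  ·-/ : ∀ n z d .{{_ : ℕ.NonZero d}} → n · (z ℚ./ d) ≡ (+ n ℤ.* z) ℚ./ d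
  ·-/ zero z (suc d) = ≡.sym (ℚₚ.fromℚᵘ-cong {mkℚᵘ (+ 0 ℤ.* z) d} {mkℚᵘ (+ 0) 0} (*≡* solve-∀))
  ·-/ (suc n) z (suc d) = ≡.trans (≡.cong (z ℚ./ suc d ℚ.+_) (·-/ n z (suc d)))
    (≡.trans (fromℚᵘ-homo-+ (mkℚᵘ z d) (mkℚᵘ (+ n ℤ.* z) d))
             (ℚₚ.fromℚᵘ-cong {mkℚᵘ z d ℚᵘ.+ mkℚᵘ (+ n ℤ.* z) d} {mkℚᵘ (+ suc n ℤ.* z) d}
               (*≡* (identity z (+ n) (+ suc d)))))
    where
    -- The cross-multiplied form of z/d + nz/d = (n + 1)z/d.
    identity : ∀ z n d → (z ℤ.* d ℤ.+ (n ℤ.* z) ℤ.* d) ℤ.* d ≡ ((+ 1 ℤ.+ n) ℤ.* z) ℤ.* (d ℤ.* d)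
    identity = solve-∀

  -- Clears the denominators in `𝓑-coeff` and `𝓑-factor`, and supplies the inverse of n + 1 behind
  -- `torsionFree`.
  d·[z/d] : ∀ z d .{{_ : ℕ.NonZero d}} → d · (z ℚ./ d) ≡ z ℚ./ 1
  d·[z/d] z d@(suc d-1) = ≡.trans (·-/ d z d)
    (ℚₚ.fromℚᵘ-cong {mkℚᵘ (+ d ℤ.* z) d-1} {mkℚᵘ z 0} (*≡* (identity z (+ d))))
    where
    identity : ∀ z d → (d ℤ.* z) ℤ.* + 1 ≡ z ℤ.* d
    identity = solve-∀

  n/1 : ∀ n → + n ℚ./ 1 ≡ n · 1ℚ
  n/1 n = ≡.sym (≡.trans (·-/ n (+ 1) 1) (≡.cong (ℚ._/ 1) (ℤₚ.*-identityʳ (+ n))))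

-- Number fields: decidable equality and characteristic zero.

module NumberFieldProperties {c ℓ : Level} (K : NumberField c ℓ) where
  open NumberField K
  open FieldProperties asField
  open Coefficients commutativeRing using (·-zeroʳ; coeff-deriv)
  open Rational
  open SemiringMult semiring using (×-congʳ; ×-assoc-*; ×-comm-*) renaming (_×_ to _·_)
  open SemiringSum semiring using (sum; sum-cong-≋; sum-replicate)
  open SemiringExp semiring using (_^_; ^-congˡ)
  open CommutativeSemiringExp commutativeSemiring using (^-distrib-*)
  open RingProperties ring using (-1*x≈-x)
  open SetoidReasoning setoid
  private
    module ℚRing = CommutativeRing ℚₚ.+-*-commutativeRing
    module ℚPoly = Poly ℚₚ.+-*-commutativeRing
    module ℚCoeff = Coefficients ℚₚ.+-*-commutativeRing
    module fromℚ = RingMorphisms.IsRingHomomorphism fromℚ-isHom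
    module Via = Evaluation ℚₚ.+-*-commutativeRing commutativeRing fromℚ fromℚ-isHom
    open SemiringMult ℚRing.semiring using () renaming (_×_ to _ℚ·_)

  -- By independence of the basis it suffices to test finitely many rational coordinates.
  _≈0? : ∀ x → Dec (x ≈ 0#)
  x ≈0? with q , x≈Σ ← spanning x with Finₚ.all? (λ i → q i ℚₚ.≟ 0ℚ)
  ... | yes q≡0 = yes (begin
    x                                 ≈⟨ x≈Σ ⟩
    sum (λ i → fromℚ (q i) * basis i)
      ≈⟨ sum-cong-≋ (λ i → trans (*-congʳ (fromℚ.⟦⟧-cong (q≡0 i))) (trans (*-congʳ fromℚ.0#-homo) (zeroˡ _))) ⟩
    sum {dim} (λ _ → 0#)              ≈⟨ sum-replicate dim ⟩
    dim · 0#                          ≈⟨ ·-zeroʳ dim ⟩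
    0#                                ∎)
  ... | no q≢0 = no λ x≈0 → q≢0 (independent q (trans (sym x≈Σ) x≈0))

  -- Multiplication by the image of 1/(n + 1) undoes multiplication by n + 1.
  torsionFree : TorsionFree
  torsionFree n x nx≈0 = begin
    x                            ≈⟨ *-identityˡ x ⟨
    1# * x                       ≈⟨ *-congʳ fromℚ.1#-homo ⟨
    fromℚ 1ℚ * x                 ≈⟨ *-congʳ (fromℚ.⟦⟧-cong (d·[z/d] (+ 1) (suc n))) ⟨
    fromℚ (suc n ℚ· r) * x       ≈⟨ *-congʳ (Via.·-homo (suc n) r) ⟩
    (suc n · fromℚ r) * x        ≈⟨ ×-assoc-* (suc n) _ _ ⟩
    suc n · (fromℚ r * x)        ≈⟨ ×-comm-* (suc n) _ _ ⟨
    fromℚ r * (suc n · x)        ≈⟨ *-congˡ nx≈0 ⟩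
    fromℚ r * 0#                 ≈⟨ zeroʳ _ ⟩
    0#                           ∎
    where r = + 1 ℚ./ suc n

  fromℤ : ℤ → Carrier
  fromℤ z = fromℚ (z ℚ./ 1)

  fromℤ-homo-* : ∀ a b → fromℤ (a ℤ.* b) ≈ fromℤ a * fromℤ b
  fromℤ-homo-* a b = trans (fromℚ.⟦⟧-cong (/1-homo-* a b)) (fromℚ.*-homo _ _)

  fromℤ-pos : ∀ n → fromℤ (+ n) ≈ n · 1#
  fromℤ-pos n = begin
    fromℤ (+ n)       ≈⟨ fromℚ.⟦⟧-cong (n/1 n) ⟩
    fromℚ (n ℚ· 1ℚ)   ≈⟨ Via.·-homo n 1ℚ ⟩
    n · fromℚ 1ℚ      ≈⟨ ×-congʳ n fromℚ.1#-homo ⟩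
    n · 1#            ∎

  fromℤ-[-1]^ : ∀ n → fromℤ (-1ℤ ℤ.^ n) ≈ (- 1#) ^ n
  fromℤ-[-1]^ zero    = fromℚ.1#-homo
  fromℤ-[-1]^ (suc n) = begin
    fromℤ (-1ℤ ℤ.* -1ℤ ℤ.^ n)     ≈⟨ fromℤ-homo-* -1ℤ (-1ℤ ℤ.^ n) ⟩
    fromℤ -1ℤ * fromℤ (-1ℤ ℤ.^ n) ≈⟨ *-cong (trans (fromℚ.-‿homo 1ℚ) (-‿cong fromℚ.1#-homo)) (fromℤ-[-1]^ n) ⟩
    (- 1#) ^ suc n                ∎

  n·1≉0 : ∀ n → .{{ℕ.NonZero n}} → ¬ (n · 1# ≈ 0#)
  n·1≉0 (suc n) n·1≈0 = 0≉1 (sym (torsionFree n 1# n·1≈0))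

  d·fromℚ[z/d] : ∀ z d .{{_ : ℕ.NonZero d}} → d · fromℚ (z ℚ./ d) ≈ fromℤ z
  d·fromℚ[z/d] z d = trans (sym (Via.·-homo d _)) (fromℚ.⟦⟧-cong (d·[z/d] z d))

  -- The derivative of `𝓑` over K.

  module _ (d k : ℕ) (k<d-1 : k < d ∸ 1) where

    -- Multiplying by k! leaves the product of the d - j for j ≤ k; each of these is positive
    -- because k < d.
    𝓑-factor≉0 : ¬ (fromℚ (𝓑-factor d k k<d-1) ≈ 0#)
    𝓑-factor≉0 factor≈0 = n·1≉0 _ {{ℕListₚ.product≢0 (Allₚ.applyUpTo⁺₁ (d ∸_) (suc k) λ {j} j≤k →
        ℕ.>-nonZero (ℕₚ.m<n⇒0<n∸m (ℕₚ.<-≤-trans j≤k (ℕₚ.≤-trans k<d-1 (ℕₚ.m∸n≤m d 1)))))}} (begin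
      ℕList.product (applyUpTo (d ∸_) (suc k)) · 1#        ≈⟨ fromℤ-pos (ℕList.product (applyUpTo (d ∸_) (suc k))) ⟨
      fromℤ (+ ℕList.product (applyUpTo (d ∸_) (suc k)))
        ≈⟨ d·fromℚ[z/d] (+ ℕList.product (applyUpTo (d ∸_) (suc k))) (k !) {{k ℕₚ.!≢0}} ⟨
      (k !) · fromℚ (𝓑-factor d k k<d-1)                     ≈⟨ ×-congʳ (k !) factor≈0 ⟩
      (k !) · 0#                                             ≈⟨ ·-zeroʳ (k !) ⟩
      0#                                                   ∎)

    -- What remains of the derivative of `𝓑` after removing `𝓑-factor` and the power x^(d-k-1).
    𝓑-sum : Carrier → Carrier
    𝓑-sum x = Via.evalVia (ℚPoly.derivFrom (d ∸ k) (applyUpTo (𝓑-coeff d k k<d-1) (suc k))) x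

    -- The weights d - k + j cancel the denominators and leave the sum of (-1)^j C(k,j) x^j, the
    -- binomial expansion of (-x + 1)^k.
    𝓑-sum≈ : ∀ x → 𝓑-sum x ≈ (1# - x) ^ k
    𝓑-sum≈ x = begin
      𝓑-sum x
        ≈⟨ Via.evalVia-derivFrom-applyUpTo (d ∸ k) (𝓑-coeff d k k<d-1) (suc k) x ⟩
      sum {suc k} (λ j → fromℚ ((d ∸ k ℕ.+ toℕ j) ℚ· 𝓑-coeff d k k<d-1 (toℕ j)) * x ^ toℕ j)
                                             ≈⟨ sum-cong-≋ {suc k} (λ j → term (toℕ j)) ⟩
      sum {suc k} (λ j → (k C toℕ j) · ((- x) ^ toℕ j * 1# ^ (k ∸ toℕ j)))
                                             ≈⟨ Binomial.theorem commutativeSemiring k (- x) 1# ⟨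
      (- x + 1#) ^ k                         ≈⟨ ^-congˡ k (+-comm _ _) ⟩
      (1# - x) ^ k                           ∎
      where
      1^ : ∀ n → 1# ^ n ≈ 1#
      1^ zero    = refl
      1^ (suc n) = trans (*-identityˡ _) (1^ n)

      term : ∀ j → fromℚ ((d ∸ k ℕ.+ j) ℚ· 𝓑-coeff d k k<d-1 j) * x ^ j ≈ (k C j) · ((- x) ^ j * 1# ^ (k ∸ j))
      term j = begin
        fromℚ ((d ∸ k ℕ.+ j) ℚ· 𝓑-coeff d k k<d-1 j) * x ^ j
          ≈⟨ *-congʳ (fromℚ.⟦⟧-cong (d·[z/d] (-1ℤ ℤ.^ j ℤ.* + (k C j)) (d ∸ k ℕ.+ j) {{denominator-nonZero d k k<d-1 j}})) ⟩
        fromℤ (-1ℤ ℤ.^ j ℤ.* + (k C j)) * x ^ j       ≈⟨ *-congʳ (fromℤ-homo-* (-1ℤ ℤ.^ j) (+ (k C j))) ⟩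
        (fromℤ (-1ℤ ℤ.^ j) * fromℤ (+ (k C j))) * x ^ j ≈⟨ *-congʳ (*-cong (fromℤ-[-1]^ j) (fromℤ-pos (k C j))) ⟩
        ((- 1#) ^ j * ((k C j) · 1#)) * x ^ j
          ≈⟨ *-congʳ (trans (×-comm-* (k C j) _ _) (×-congʳ (k C j) (*-identityʳ _))) ⟩
        ((k C j) · (- 1#) ^ j) * x ^ j                ≈⟨ ×-assoc-* (k C j) _ _ ⟩
        (k C j) · ((- 1#) ^ j * x ^ j)                ≈⟨ ×-congʳ (k C j) (^-distrib-* (- 1#) x j) ⟨
        (k C j) · ((- 1# * x) ^ j)                    ≈⟨ ×-congʳ (k C j) (^-congˡ j (-1*x≈-x x)) ⟩
        (k C j) · ((- x) ^ j)
          ≈⟨ ×-congʳ (k C j) (trans (*-congˡ (1^ (k ∸ j))) (*-identityʳ _)) ⟨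
        (k C j) · ((- x) ^ j * 1# ^ (k ∸ j))          ∎

    derivVia-𝓑 : ∀ m → d ∸ k ≡ suc m → ∀ x →
      Via.derivVia (𝓑 d k k<d-1) x ≈ fromℚ (𝓑-factor d k k<d-1) * (x ^ m * (1# - x) ^ k)
    derivVia-𝓑 m d∸k≡1+m x =
      trans (Via.derivVia-• (𝓑-factor d k k<d-1) (ℚPoly.X ℚPoly.^ₚ (d ∸ k) ℚPoly.*ₚ L) x)
            (*-congˡ (trans (shifted (d ∸ k) d∸k≡1+m) (*-congˡ (𝓑-sum≈ x))))
      where
      L = applyUpTo (𝓑-coeff d k k<d-1) (suc k)
      -- `d ∸ k` is generalised to a variable so that its equation with `suc m` can be matched; the
      -- denominators inside `L` stay untouched.
      shifted : ∀ M → M ≡ suc m → Via.derivVia (ℚPoly.X ℚPoly.^ₚ M ℚPoly.*ₚ L) x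
                                  ≈ x ^ m * Via.evalVia (ℚPoly.derivFrom M L) x
      shifted _ ≡.refl = Via.derivVia-X^*ₚ m L x

    -- Differentiation commutes with applying `fromℚ` to the coefficients, so the computation over ℚ
    -- carries over to K.
    eval-deriv-𝓑 : ∀ m → d ∸ k ≡ suc m → ∀ x →
      eval (deriv (map fromℚ (𝓑 d k k<d-1))) x ≈ fromℚ (𝓑-factor d k k<d-1) * (x ^ m * (1# - x) ^ k)
    eval-deriv-𝓑 m d∸k≡1+m x = begin
      eval (deriv (map fromℚ B)) x
        ≈⟨ eval-cong (deriv (map fromℚ B)) (map fromℚ (ℚPoly.deriv B)) deriv-map refl ⟩
      eval (map fromℚ (ℚPoly.deriv B)) x      ≡⟨ Via.evalVia-map (ℚPoly.deriv B) x ⟨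
      Via.derivVia B x                        ≈⟨ derivVia-𝓑 m d∸k≡1+m x ⟩
      fromℚ (𝓑-factor d k k<d-1) * (x ^ m * (1# - x) ^ k) ∎
      where
      B = 𝓑 d k k<d-1
      deriv-map : deriv (map fromℚ B) ≈ₚ map fromℚ (ℚPoly.deriv B)
      deriv-map n = begin
        coeff (deriv (map fromℚ B)) n          ≈⟨ coeff-deriv (map fromℚ B) n ⟩
        suc n · coeff (map fromℚ B) (suc n)    ≈⟨ ×-congʳ (suc n) (Via.coeff-map B (suc n)) ⟩
        suc n · fromℚ (ℚPoly.coeff B (suc n))  ≈⟨ Via.·-homo (suc n) _ ⟨
        fromℚ (suc n ℚ· ℚPoly.coeff B (suc n)) ≈⟨ fromℚ.⟦⟧-cong (ℚCoeff.coeff-deriv B n) ⟨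
        fromℚ (ℚPoly.coeff (ℚPoly.deriv B) n)  ≈⟨ Via.coeff-map (ℚPoly.deriv B) n ⟨
        coeff (map fromℚ (ℚPoly.deriv B)) n    ∎

-- Affine conjugation and the comparison with `𝓑`.

module NormalForm {c ℓ : Level} (K : NumberField c ℓ) where
  open NumberField K
  open FieldProperties asField
  open NumberFieldProperties K
  open CharacteristicZero asField torsionFree
  open Coefficients commutativeRing
  open AffineMaps asField
  open SemiringExp semiring using (_^_; ^-congˡ)
  open CommutativeSemiringExp commutativeSemiring using (^-distrib-*)
  open RingProperties ring using (-‿distribˡ-*; -‿distribʳ-*; ⁻¹-anti-homo-//; -‿involutive; x∙y⁻¹≈ε⇒x≈y; xyx⁻¹≈y)
  open SemiringSolver commutativeSemiring using (solve; _:=_; _:+_; _:*_)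
  open SetoidReasoning setoid

  eval-toPoly : ∀ φ x → eval (toPoly φ) x ≈ Affine.α φ * x + Affine.β φ
  eval-toPoly (affine α β _) x = begin
    eval (α • X +ₚ constant β) x          ≈⟨ eval-+ₚ (α • X) (constant β) x ⟩
    eval (α • X) x + eval (constant β) x  ≈⟨ +-cong (eval-• α X x) (eval-constant β x) ⟩
    α * eval X x + β                      ≈⟨ +-congʳ (*-congˡ (eval-X x)) ⟩
    α * x + β                             ∎

  eval-deriv-toPoly : ∀ φ x → eval (deriv (toPoly φ)) x ≈ Affine.α φ
  eval-deriv-toPoly (affine α β _) x = begin
    eval (deriv (α • X +ₚ constant β)) x  ≈⟨ eval-deriv-+ₚ (α • X) (constant β) x ⟩
    eval (deriv (α • X)) x + 0#           ≈⟨ +-identityʳ _ ⟩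
    eval (deriv (α • X)) x                ≈⟨ eval-deriv-• α X x ⟩
    α * eval (deriv X) x                  ≈⟨ *-congˡ (eval-deriv-X x) ⟩
    α * 1#                                ≈⟨ *-identityʳ α ⟩
    α                                     ∎

  inv-inverseˡ : ∀ x (x≉0 : ¬ (x ≈ 0#)) → inv x x≉0 * x ≈ 1#
  inv-inverseˡ x x≉0 = proj₁ (proj₂ (invertible x x≉0))

  inv-inverseʳ : ∀ x (x≉0 : ¬ (x ≈ 0#)) → x * inv x x≉0 ≈ 1#
  inv-inverseʳ x x≉0 = proj₂ (proj₂ (invertible x x≉0))

  -- In the chain rule the slopes of φ and of its inverse cancel.
  eval-deriv-conjugate : ∀ φ g x → eval (deriv (conjugate φ g)) x ≈ eval (deriv g) (eval (toPoly (inverse φ)) x)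
  eval-deriv-conjugate φ g x = begin
    eval (deriv (toPoly φ ∘ₚ g ∘ₚ L)) x           ≈⟨ eval-deriv-∘ₚ (toPoly φ) (g ∘ₚ L) x ⟩
    eval (deriv (toPoly φ)) (eval (g ∘ₚ L) x) * eval (deriv (g ∘ₚ L)) x
      ≈⟨ *-cong (eval-deriv-toPoly φ (eval (g ∘ₚ L) x)) (eval-deriv-∘ₚ g L x) ⟩
    α * (g′ * eval (deriv L) x)                   ≈⟨ *-congˡ (*-congˡ (eval-deriv-toPoly (inverse φ) x)) ⟩
    α * (g′ * α⁻¹)
      ≈⟨ solve 3 (λ a g b → a :* (g :* b) := (a :* b) :* g) refl α g′ α⁻¹ ⟩
    (α * α⁻¹) * g′                                ≈⟨ *-congʳ (inv-inverseʳ α (Affine.α≉0 φ)) ⟩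
    1# * g′                                       ≈⟨ *-identityˡ g′ ⟩
    g′                                            ∎
    where
    L   = toPoly (inverse φ)
    α   = Affine.α φ
    α⁻¹ = Affine.α (inverse φ)
    g′  = eval (deriv g) (eval L x)

  module _ (γ₁ γ₂ : Carrier) (γ₁≉γ₂ : ¬ (γ₁ ≈ γ₂)) where

    δ : Carrier
    δ = γ₂ - γ₁

    δ≉0 : ¬ (δ ≈ 0#)
    δ≉0 δ≈0 = γ₁≉γ₂ (sym (x∙y⁻¹≈ε⇒x≈y γ₂ γ₁ δ≈0))

    -- The map z ↦ (z - γ₁)/δ.
    normaliser : Affine
    normaliser = affine (inv δ δ≉0) (- (inv δ δ≉0 * γ₁)) (inv≉0 δ δ≉0)

    -- `inverse` inverts the slope 1/δ once more; the result equals δ only up to `_≈_`, by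
    -- cancellation against 1/δ.
    eval-inverse-normaliser : ∀ x → eval (toPoly (inverse normaliser)) x ≈ δ * x + γ₁
    eval-inverse-normaliser x = trans (eval-toPoly (inverse normaliser) x) (+-cong (*-congʳ α⁻¹≈δ) shift)
      where
      α   = Affine.α normaliser
      α⁻¹ = Affine.α (inverse normaliser)
      α⁻¹≈δ : α⁻¹ ≈ δ
      α⁻¹≈δ = begin
        α⁻¹             ≈⟨ *-identityʳ _ ⟨
        α⁻¹ * 1#        ≈⟨ *-congˡ (inv-inverseˡ δ δ≉0) ⟨
        α⁻¹ * (α * δ)   ≈⟨ *-assoc _ _ _ ⟨
        (α⁻¹ * α) * δ   ≈⟨ *-congʳ (inv-inverseˡ α (Affine.α≉0 normaliser)) ⟩
        1# * δ          ≈⟨ *-identityˡ δ ⟩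
        δ               ∎
      shift : - (α⁻¹ * - (α * γ₁)) ≈ γ₁
      shift = begin
        - (α⁻¹ * - (α * γ₁))   ≈⟨ -‿distribʳ-* α⁻¹ _ ⟩
        α⁻¹ * - - (α * γ₁)     ≈⟨ *-congˡ (-‿involutive _) ⟩
        α⁻¹ * (α * γ₁)         ≈⟨ *-assoc _ _ _ ⟨
        (α⁻¹ * α) * γ₁         ≈⟨ *-congʳ (inv-inverseˡ α (Affine.α≉0 normaliser)) ⟩
        1# * γ₁                ≈⟨ *-identityˡ γ₁ ⟩
        γ₁                     ∎

    δx+γ₁-γ₁ : ∀ x → (δ * x + γ₁) - γ₁ ≈ δ * x
    δx+γ₁-γ₁ x = trans (+-assoc _ _ _) (trans (+-congˡ (-‿inverseʳ γ₁)) (+-identityʳ _))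

    -- Here γ₁ - γ₂ = -δ. Taking out -δ leaves 1 - x, the base of the power in `𝓑-sum≈`.
    δx+γ₁-γ₂ : ∀ x → (δ * x + γ₁) - γ₂ ≈ - δ * (1# - x)
    δx+γ₁-γ₂ x = begin
      (δ * x + γ₁) - γ₂       ≈⟨ +-assoc _ _ _ ⟩
      δ * x + (γ₁ - γ₂)       ≈⟨ +-cong (-‿involutive _) (⁻¹-anti-homo-// γ₂ γ₁) ⟨
      - - (δ * x) + - δ       ≈⟨ +-comm _ _ ⟩
      - δ + - - (δ * x)
        ≈⟨ +-cong (sym (*-identityʳ _)) (trans (-‿cong (-‿distribˡ-* δ x)) (-‿distribʳ-* (- δ) x)) ⟩
      - δ * 1# + - δ * - x    ≈⟨ distribˡ _ _ _ ⟨
      - δ * (1# - x)          ∎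

    module _ (g : Polynomial) (m n : ℕ) (b : Carrier)
      (g′ : ∀ x → eval (deriv g) x ≈ (x - γ₁) ^ suc m * ((x - γ₂) ^ suc n * b)) where

      -- Collects b with the powers of δ and -δ that come out of the two linear factors.
      scale : Carrier
      scale = b * (δ ^ suc m * (- δ) ^ suc n)

      eval-deriv-conjugate-normaliser : ∀ x →
        eval (deriv (conjugate normaliser g)) x ≈ scale * (x ^ suc m * (1# - x) ^ suc n)
      eval-deriv-conjugate-normaliser x = begin
        eval (deriv (conjugate normaliser g)) x            ≈⟨ eval-deriv-conjugate normaliser g x ⟩
        eval (deriv g) y                                   ≈⟨ g′ y ⟩
        (y - γ₁) ^ suc m * ((y - γ₂) ^ suc n * b)
          ≈⟨ *-cong (^-congˡ (suc m) (trans (+-congʳ (eval-inverse-normaliser x)) (δx+γ₁-γ₁ x)))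
               (*-congʳ (^-congˡ (suc n) (trans (+-congʳ (eval-inverse-normaliser x)) (δx+γ₁-γ₂ x)))) ⟩
        (δ * x) ^ suc m * ((- δ * (1# - x)) ^ suc n * b)
          ≈⟨ *-cong (^-distrib-* δ x (suc m)) (*-congʳ (^-distrib-* (- δ) (1# - x) (suc n))) ⟩
        (δ ^ suc m * x ^ suc m) * (((- δ) ^ suc n * (1# - x) ^ suc n) * b)
          ≈⟨ solve 5 (λ d x e y b → (d :* x) :* ((e :* y) :* b) := (b :* (d :* e)) :* (x :* y)) refl
               (δ ^ suc m) (x ^ suc m) ((- δ) ^ suc n) ((1# - x) ^ suc n) b ⟩
        scale * (x ^ suc m * (1# - x) ^ suc n)                 ∎
        where y = eval (toPoly (inverse normaliser)) x

      -- With k the exponent of z - γ₂ in g′, both derivatives are constant multiples of x^(m+1) (1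
      -- - x)^(n+1).
      conjugate≈𝓑 : ∀ d → d ≡ suc (suc m ℕ.+ suc n) →
        ∃ λ k → 1 ≤ k × (Σ (k < d ∸ 1) λ k<d-1 → ∃ λ a → ∃ λ c →
          conjugate normaliser g ≈ₚ a • map fromℚ (𝓑 d k k<d-1) +ₚ constant c)
      conjugate≈𝓑 d ≡.refl = suc n , s≤s z≤n , k<d-1 , a , c₀ , equal
        where
        k<d-1 : suc n < suc m ℕ.+ suc n
        k<d-1 = ℕₚ.m<n+m (suc n) (s≤s z≤n)
        factor   = fromℚ (𝓑-factor d (suc n) k<d-1)
        factor≉0 = 𝓑-factor≉0 d (suc n) k<d-1
        G  = conjugate normaliser g
        B  = map fromℚ (𝓑 d (suc n) k<d-1)
        -- The quotient of the constant factors of the two derivatives.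
        a  = scale * inv factor factor≉0
        -- Equality of derivatives says nothing about the constant terms, so their difference is
        -- added.
        c₀ = coeff G 0 - coeff (a • B) 0

        derivs : ∀ x → eval (deriv G) x ≈ eval (deriv (a • B)) x
        derivs x = begin
          eval (deriv G) x                                 ≈⟨ eval-deriv-conjugate-normaliser x ⟩
          scale * z
            ≈⟨ *-congʳ (trans (*-congˡ (inv-inverseˡ factor factor≉0)) (*-identityʳ scale)) ⟨
          (scale * (inv factor factor≉0 * factor)) * z
            ≈⟨ solve 4 (λ c i f z → (c :* (i :* f)) :* z := (c :* i) :* (f :* z)) refl scale (inv factor factor≉0) factor z ⟩
          a * (factor * z)
            -- Here d - k = m + 2, so the exponent of x is m + 1.
            ≈⟨ *-congˡ (eval-deriv-𝓑 d (suc n) k<d-1 (suc m) (ℕₚ.m+n∸n≡m (suc (suc m)) (suc n)) x) ⟨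
          a * eval (deriv B) x                             ≈⟨ eval-deriv-• a B x ⟨
          eval (deriv (a • B)) x                           ∎
          where z = x ^ suc m * (1# - x) ^ suc n

        equal : G ≈ₚ a • B +ₚ constant c₀
        equal zero = sym (begin
          coeff (a • B +ₚ constant c₀) 0                       ≈⟨ coeff-+ₚ (a • B) (constant c₀) 0 ⟩
          coeff (a • B) 0 + (coeff G 0 - coeff (a • B) 0)      ≈⟨ +-assoc _ _ _ ⟨
          coeff (a • B) 0 + coeff G 0 - coeff (a • B) 0        ≈⟨ xyx⁻¹≈y _ _ ⟩
          coeff G 0                                            ∎)
        equal (suc i) = begin
          coeff G (suc i)
            ≈⟨ deriv-injective G (a • B) (eval-injective (deriv G) (deriv (a • B)) derivs) i ⟩
          coeff (a • B) (suc i)                   ≈⟨ +-identityʳ _ ⟨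
          coeff (a • B) (suc i) + 0#              ≈⟨ coeff-+ₚ (a • B) (constant c₀) (suc i) ⟨
          coeff (a • B +ₚ constant c₀) (suc i)    ∎

-- From critical points in the closure to a factorisation of g′ over K.

module CriticalPoints {c ℓ c′ ℓ′ : Level} (K : NumberField c ℓ)
                      (K̄ : AlgebraicClosure (NumberField.asField K) c′ ℓ′) where
  open NumberField K
  open AlgebraicClosure K̄
  open Critical asField K̄
  open FieldProperties asField
  open NumberFieldProperties K
  open CharacteristicZero asField torsionFree
  open DecidableField asField _≈0?
  open Coefficients commutativeRing
  open SemiringExp semiring using (_^_)
  open RingProperties ring using (x∙y⁻¹≈ε⇒x≈y)
  private
    module K̄ = Field closure
    module embed = RingMorphisms.IsRingHomomorphism embed-isHom
    module Via = Evaluation commutativeRing K̄.commutativeRing embed embed-isHom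

  -- If x were nonzero, it would have an inverse, and its image being 0 would give 0 = 1 in the
  -- closure.
  embed≈0⇒≈0 : ∀ x → embed x K̄.≈ K̄.0# → x ≈ 0#
  embed≈0⇒≈0 x ex≈0 with x ≈0?
  ... | yes x≈0 = x≈0
  ... | no  x≉0 with y , yx≈1 , _ ← invertible x x≉0 = contradiction (begin
    K̄.0#                    ≈⟨ K̄.zeroʳ _ ⟨
    embed y K̄.* K̄.0#        ≈⟨ K̄.*-congˡ ex≈0 ⟨
    embed y K̄.* embed x     ≈⟨ embed.*-homo y x ⟨
    embed (y * x)           ≈⟨ embed.⟦⟧-cong yx≈1 ⟩
    embed 1#                ≈⟨ embed.1#-homo ⟩
    K̄.1#                    ∎) K̄.0≉1
    where open SetoidReasoning K̄.setoid

  HasDegree-map : ∀ p {n} → HasDegree p n → K̄.HasDegree (map embed p) n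
  HasDegree-map p {n} (pₙ≉0 , p>n) =
    (λ ≈0 → pₙ≉0 (embed≈0⇒≈0 _ (K̄.trans (K̄.sym (Via.coeff-map p n)) ≈0))) ,
    λ m n<m → K̄.trans (Via.coeff-map p m) (K̄.trans (embed.⟦⟧-cong (p>n m n<m)) embed.0#-homo)

  -- In positive degree algebraic closedness would supply a root.
  degree≡0 : ∀ p {n} → HasDegree p n → (∀ x → ¬ (Via.evalVia p x K̄.≈ K̄.0#)) → n ≡ 0
  degree≡0 p {zero}  deg noRoot = ≡.refl
  degree≡0 p {suc n} deg noRoot with x , root ← closed (map embed p) (suc n) (s≤s z≤n) (HasDegree-map p deg) =
    contradiction (K̄.trans (K̄.reflexive (Via.evalVia-map p x)) root) (noRoot x)

  module _ (g : Polynomial) (γ₁ γ₂ : Carrier) (critical : CriticalPoint g ≐ ｛ embed γ₁ , embed γ₂ ｝) where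

    -- If γ₁ = γ₂, the two distinct critical points x and y would both equal the image of γ₁.
    distinct : Bicritical g → ¬ (γ₁ ≈ γ₂)
    distinct (x , y , x≉y , xy) γ₁≈γ₂ = x≉y (K̄.trans (only x (inj₁ K̄.refl)) (K̄.sym (only y (inj₂ K̄.refl))))
      where
      only : ∀ z → ｛ x , y ｝ z → z K̄.≈ embed γ₁
      only z z∈ = [ id , (λ z≈ → K̄.trans z≈ (K̄.sym (embed.⟦⟧-cong γ₁≈γ₂))) ]′ (proj₁ critical (proj₂ xy z∈))

    critical⇒root : ∀ γ → CriticalPoint g (embed γ) → eval (deriv g) γ ≈ 0#
    critical⇒root γ crit = embed≈0⇒≈0 _ (K̄.trans (K̄.sym (Via.evalVia-f (deriv g) γ))
      (K̄.trans (K̄.reflexive (Via.evalVia-map (deriv g) (embed γ))) crit))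

    -- Here d is the degree of g′, one less than that of g. The successors record that both γ₁ and
    -- γ₂ occur as roots.
    Factorisation : ℕ → Set (c ⊔ ℓ)
    Factorisation d = ∃ λ m → ∃ λ n → ∃ λ b → d ≡ suc m ℕ.+ suc n ×
      (∀ x → eval (deriv g) x ≈ (x - γ₁) ^ suc m * ((x - γ₂) ^ suc n * b))

    -- Both exponents are positive because γ₁ and γ₂ are roots of g′. Having no root in the closure,
    -- h is constant, and the exponents then add up to the degree of g′.
    cofactor-constant : ¬ (γ₁ ≈ γ₂) → ∀ d → HasDegree g (suc d) → ∀ m n q h →
      deriv g ≈ₚ mulLinearPow γ₁ m q → ¬ (eval q γ₁ ≈ 0#) →
      q ≈ₚ mulLinearPow γ₂ n h → ¬ (eval h γ₂ ≈ 0#) → Factorisation d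
    cofactor-constant γ₁≉γ₂ d deg m n q h g′≈ q[γ₁]≉0 q≈ h[γ₂]≉0 = go m n g′≈ q≈
      where
      go : ∀ m n → deriv g ≈ₚ mulLinearPow γ₁ m q → q ≈ₚ mulLinearPow γ₂ n h → Factorisation d
      -- With exponent 0 at γ₁, q would be g′, which vanishes at γ₁.
      go zero n g′≈ q≈ = contradiction
        (trans (sym (eval-cong (deriv g) q g′≈ refl)) (critical⇒root γ₁ (proj₂ critical (inj₁ K̄.refl)))) q[γ₁]≉0
      -- With exponent 0 at γ₂, h would be q. Since g′ vanishes at γ₂ and γ₂ - γ₁ is nonzero, q
      -- would vanish there.
      go (suc m) zero g′≈ q≈ = contradiction
        (trans (sym (eval-cong q h q≈ refl))
          (x*y≈0⇒y≈0 (x^n≉0 (suc m) (λ γ₂-γ₁≈0 → γ₁≉γ₂ (sym (x∙y⁻¹≈ε⇒x≈y γ₂ γ₁ γ₂-γ₁≈0))))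
            (trans (sym (eval-mulLinearPow γ₁ (suc m) q γ₂))
              (trans (sym (eval-cong (deriv g) (mulLinearPow γ₁ (suc m) q) g′≈ refl))
                (critical⇒root γ₂ (proj₂ critical (inj₂ K̄.refl)))))))
        h[γ₂]≉0
      go (suc m) (suc n) g′≈ q≈ = finish (degree? h)
        where
        full : Polynomial
        full = mulLinearPow γ₁ (suc m) (mulLinearPow γ₂ (suc n) h)

        g′≈full : deriv g ≈ₚ full
        g′≈full i = trans (g′≈ i) (mulLinearPow-cong γ₁ (suc m) q (mulLinearPow γ₂ (suc n) h) q≈ i)

        -- h divides q, and q does not vanish at γ₁.
        h[γ₁]≉0 : ¬ (eval h γ₁ ≈ 0#)
        h[γ₁]≉0 h[γ₁]≈0 = q[γ₁]≉0 (trans (eval-cong q (mulLinearPow γ₂ (suc n) h) q≈ refl)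
          (trans (eval-mulLinearPow γ₂ (suc n) h γ₁) (trans (*-congˡ h[γ₁]≈0) (zeroʳ _))))

        -- A root of h is a critical point, hence the image of γ₁ or γ₂, and h vanishes at neither.
        noRoot : ∀ x → ¬ (Via.evalVia h x K̄.≈ K̄.0#)
        noRoot x root = [ absurd γ₁ h[γ₁]≉0 , absurd γ₂ h[γ₂]≉0 ]′ (proj₁ critical crit)
          where
          open SetoidReasoning K̄.setoid
          open SemiringExp K̄.semiring using () renaming (_^_ to _K̄^_)
          absurd : ∀ γ → ¬ (eval h γ ≈ 0#) → ¬ (x K̄.≈ embed γ)
          absurd γ h[γ]≉0 x≈γ = h[γ]≉0 (embed≈0⇒≈0 _ (begin
            embed (eval h γ)         ≈⟨ Via.evalVia-f h γ ⟨
            Via.evalVia h (embed γ)  ≈⟨ Via.evalVia-cong h h (λ _ → refl) x≈γ ⟨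
            Via.evalVia h x          ≈⟨ root ⟩
            K̄.0#                     ∎))
          crit : CriticalPoint g x
          crit = begin
            K̄.eval (map embed (deriv g)) x     ≡⟨ Via.evalVia-map (deriv g) x ⟨
            Via.evalVia (deriv g) x            ≈⟨ Via.evalVia-cong (deriv g) full g′≈full K̄.refl ⟩
            Via.evalVia full x                 ≈⟨ Via.evalVia-mulLinearPow γ₁ (suc m) (mulLinearPow γ₂ (suc n) h) x ⟩
            (x K̄.- embed γ₁) K̄^ suc m K̄.* Via.evalVia (mulLinearPow γ₂ (suc n) h) x
              ≈⟨ K̄.*-congˡ (K̄.trans (Via.evalVia-mulLinearPow γ₂ (suc n) h x) (K̄.trans (K̄.*-congˡ root) (K̄.zeroʳ _))) ⟩
            (x K̄.- embed γ₁) K̄^ suc m K̄.* K̄.0# ≈⟨ K̄.zeroʳ _ ⟩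
            K̄.0#                               ∎

        finish : h ≈ₚ [] ⊎ ∃ (HasDegree h) → Factorisation d
        finish (inj₁ h≈[]) = contradiction (eval-cong h [] h≈[] refl) h[γ₂]≉0
        finish (inj₂ (e , deg-h)) with ≡.refl ← degree≡0 h deg-h noRoot =
          m , n , coeff h 0 ,
          -- Comparing degrees on both sides of the factorisation gives d = (m + 1) + ((n + 1) + 0).
          ≡.trans (HasDegree-unique (deriv g) full g′≈full (HasDegree-deriv g deg)
                    (HasDegree-mulLinearPow γ₁ (suc m) (mulLinearPow γ₂ (suc n) h)
                      (HasDegree-mulLinearPow γ₂ (suc n) h deg-h)))
                  (≡.cong (suc m ℕ.+_) (ℕₚ.+-identityʳ (suc n))) ,
          λ x → trans (eval-cong (deriv g) full g′≈full refl)
                  (trans (eval-mulLinearPow γ₁ (suc m) (mulLinearPow γ₂ (suc n) h) x)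
                    (*-congˡ (trans (eval-mulLinearPow γ₂ (suc n) h x) (*-congˡ (eval-HasDegree-0 h x deg-h)))))

    factor-deriv : ¬ (γ₁ ≈ γ₂) → ∀ d → HasDegree g (suc d) → Factorisation d
    factor-deriv γ₁≉γ₂ d deg =
      let m , q , g′≈ , q[γ₁]≉0 = splitRoot γ₁ (deriv g) (λ g′≈[] → proj₁ (HasDegree-deriv g deg) (g′≈[] d))
          -- The nonzero value of q at γ₁ also shows that q is not the zero polynomial, so it can be
          -- split at γ₂.
          n , h , q≈ , h[γ₂]≉0  = splitRoot γ₂ q (λ q≈[] → q[γ₁]≉0 (eval-cong q [] q≈[] refl))
      in cofactor-constant γ₁≉γ₂ d deg m n q h g′≈ q[γ₁]≉0 q≈ h[γ₂]≉0

proposition3p3 : {e ℓ e′ ℓ′ : Level} (K : NumberField e ℓ) →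
    let open NumberField K in
    (K̄ : AlgebraicClosure asField e′ ℓ′) →
    let open AlgebraicClosure K̄ using (embed)
        open Critical asField K̄
        open AffineMaps asField in
    (g : Polynomial) (d : ℕ) → 3 ≤ d → HasDegree g d →
    Bicritical g →
    (γ₁ γ₂ : Carrier) → CriticalPoint g ≐ ｛ embed γ₁ , embed γ₂ ｝ →
    ∃ λ (φ : Affine) →
    ∃ λ (k : ℕ) → 1 ≤ k × (Σ (k < d ∸ 1) λ k<d-1 →
    ∃ λ (a : Carrier) → ∃ λ (c : Carrier) →
    conjugate φ g ≈ₚ a • map fromℚ (𝓑 d k k<d-1) +ₚ constant c)
-- Matching the degree of g as `suc d` makes `d` the degree of g′; `3≤d` excludes degree 0.
proposition3p3 K K̄ g (suc d) 3≤d deg bicritical γ₁ γ₂ critical =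
  let γ₁≉γ₂ = distinct g γ₁ γ₂ critical bicritical
      m , n , b , d≡ , g′ = factor-deriv g γ₁ γ₂ critical γ₁≉γ₂ d deg
  in normaliser γ₁ γ₂ γ₁≉γ₂ , conjugate≈𝓑 γ₁ γ₂ γ₁≉γ₂ g m n b g′ (suc d) (≡.cong suc d≡)
  where
  open NormalForm K
  open CriticalPoints K K̄
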